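{- Let $k\ge1$. Any language over a $k$-letter alphabet that is definable by a two-variable sentence (a sentence of $\mathrm{FO}^2[<]$) is definable by a two-variable sentence in which the number of quantifier blocks is $k$.
   Context: $\mathrm{FO}^2[<]$ over a finite alphabet $A$ is first-order logic interpreted in finite words over $A$: variables range over positions of the word, the atomic formulas are $x<y$, $x=y$, and $a(x)$ for $a\in A$ ("the letter at position $x$ is $a$"), and only two variable symbols $x,y$ may be used (each may be requantified any number of times). A sentence defines the language of all words in $A^*$ satisfying it. The number of quantifier blocks of a formula is computed after pushing negations to the atoms: it is the maximum, over all root-to-leaf paths in the parse tree, of the number of maximal blocks of consecutive quantifiers of the same type (all $\exists$ or all $\forall$) in the sequence of quantifiers met along the path. The $n$-th level of the quantifier alternation hierarchy consists of the languages definable by two-variable sentences with $n$ quantifier blocks in this sense (blocks can always be padded with vacuous quantifiers, so "$n$" may be read as "at most $n$"). -}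

module Defs where

open import Level using (0ℓ)
open import Data.Nat.Base using (ℕ; _⊔_)
open import Data.Fin.Base using (Fin; zero; suc; _<_)
open import Data.Fin.Subset using (Subset; inside; _∈_) renaming (⊥ to ∅)
open import Data.Vec.Base using (_∷_; _[_]≔_; here; there)
open import Data.List.Base using (List; []; _∷_; _++_; map; length; lookup; foldr; derun)
open import Data.Product.Base using (Σ-syntax; ∃-syntax; _×_)
open import Data.Sum.Base using (_⊎_)
open import Function.Bundles using (_⇔_)
open import Relation.Binary.Definitions using (DecidableEquality)
open import Relation.Binary.PropositionalEquality using (_≡_; refl)
open import Relation.Nullary using (¬_; yes; no)
open import Relation.Unary using (Pred)

Var : Set
Var = Fin 2

infix  8 _≺_ _≐_
infix  7 ¬′_
infixr 6 _∧′_
infixr 5 _∨′_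

-- Formula A Γ: formulas whose free variables all belong to Γ.  A quantifier
-- may rebind a variable that is already in Γ, so each of the two variables
-- can be reused any number of times.
data Formula (A : Set) : Subset 2 → Set where
  _≺_  : ∀ {Γ} {u v : Var} → u ∈ Γ → v ∈ Γ → Formula A Γ
  _≐_  : ∀ {Γ} {u v : Var} → u ∈ Γ → v ∈ Γ → Formula A Γ
  letter : ∀ {Γ} {v : Var} → A → v ∈ Γ → Formula A Γ
  ¬′_  : ∀ {Γ} → Formula A Γ → Formula A Γ
  _∧′_ : ∀ {Γ} → Formula A Γ → Formula A Γ → Formula A Γ
  _∨′_ : ∀ {Γ} → Formula A Γ → Formula A Γ → Formula A Γ
  ∃′   : ∀ {Γ} (v : Var) → Formula A (Γ [ v ]≔ inside) → Formula A Γ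
  ∀′   : ∀ {Γ} (v : Var) → Formula A (Γ [ v ]≔ inside) → Formula A Γ

Sentence : Set → Set
Sentence A = Formula A ∅

-- Assignments are defined only on the variables in scope, so that sentences
-- can be evaluated in the empty word, which has no positions.
Env : ∀ {m} → Subset m → ℕ → Set
Env Γ n = ∀ {v} → v ∈ Γ → Fin n

emptyEnv : ∀ {n} → Env {2} ∅ n
emptyEnv (there (there ()))

-- The assignment that sends v to i and agrees with ρ on all other variables.
update : ∀ {m n} {Γ : Subset m} → Env Γ n → (v : Fin m) → Fin n → Env (Γ [ v ]≔ inside) n
update {Γ = _ ∷ _} ρ zero    i here      = i
update {Γ = _ ∷ _} ρ zero    i (there p) = ρ (there p)
update {Γ = _ ∷ _} ρ (suc v) i here      = ρ here
update {Γ = _ ∷ _} ρ (suc v) i (there p) = update (λ q → ρ (there q)) v i p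

Sat : ∀ {A Γ} (w : List A) → Env Γ (length w) → Formula A Γ → Set
Sat w ρ (p ≺ q)      = ρ p < ρ q
Sat w ρ (p ≐ q)      = ρ p ≡ ρ q
Sat w ρ (letter a p) = lookup w (ρ p) ≡ a
Sat w ρ (¬′ φ)       = ¬ Sat w ρ φ
Sat w ρ (φ ∧′ ψ)     = Sat w ρ φ × Sat w ρ ψ
Sat w ρ (φ ∨′ ψ)     = Sat w ρ φ ⊎ Sat w ρ ψ
Sat w ρ (∃′ v φ)     = ∃[ i ] Sat w (update ρ v i) φ
Sat w ρ (∀′ v φ)     = ∀ i → Sat w (update ρ v i) φ

infix 4 _⊨_

_⊨_ : ∀ {A} → List A → Sentence A → Set
w ⊨ φ = Sat w emptyEnv φ

-- nnf φ pushes the negations of φ to the atoms; nnf¬ φ does so for ¬′ φ.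
mutual
  nnf : ∀ {A Γ} → Formula A Γ → Formula A Γ
  nnf (p ≺ q)      = p ≺ q
  nnf (p ≐ q)      = p ≐ q
  nnf (letter a p) = letter a p
  nnf (¬′ φ)       = nnf¬ φ
  nnf (φ ∧′ ψ)     = nnf φ ∧′ nnf ψ
  nnf (φ ∨′ ψ)     = nnf φ ∨′ nnf ψ
  nnf (∃′ v φ)     = ∃′ v (nnf φ)
  nnf (∀′ v φ)     = ∀′ v (nnf φ)

  nnf¬ : ∀ {A Γ} → Formula A Γ → Formula A Γ
  nnf¬ (p ≺ q)      = ¬′ (p ≺ q)
  nnf¬ (p ≐ q)      = ¬′ (p ≐ q)
  nnf¬ (letter a p) = ¬′ letter a p
  nnf¬ (¬′ φ)       = nnf φ
  nnf¬ (φ ∧′ ψ)     = nnf¬ φ ∨′ nnf¬ ψ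
  nnf¬ (φ ∨′ ψ)     = nnf¬ φ ∧′ nnf¬ ψ
  nnf¬ (∃′ v φ)     = ∀′ v (nnf¬ φ)
  nnf¬ (∀′ v φ)     = ∃′ v (nnf¬ φ)

data Quantifier : Set where
  ex all : Quantifier

_≟Q_ : DecidableEquality Quantifier
ex  ≟Q ex  = yes refl
ex  ≟Q all = no λ ()
all ≟Q ex  = no λ ()
all ≟Q all = yes refl

-- The sequences of quantifiers met along the root-to-leaf paths of the parse tree.
paths : ∀ {A Γ} → Formula A Γ → List (List Quantifier)
paths (_ ≺ _)      = [] ∷ []
paths (_ ≐ _)      = [] ∷ []
paths (letter _ _) = [] ∷ []
paths (¬′ φ)       = paths φ
paths (φ ∧′ ψ)     = paths φ ++ paths ψ
paths (φ ∨′ ψ)     = paths φ ++ paths ψ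
paths (∃′ _ φ)     = map (ex ∷_) (paths φ)
paths (∀′ _ φ)     = map (all ∷_) (paths φ)

-- derun collapses each maximal run of equal quantifiers to a single entry.
blocks : List Quantifier → ℕ
blocks qs = length (derun _≟Q_ qs)

numBlocks : ∀ {A Γ} → Formula A Γ → ℕ
numBlocks φ = foldr _⊔_ 0 (map blocks (paths (nnf φ)))

Language : Set → Set₁
Language A = Pred (List A) 0ℓ

_Defines_ : ∀ {A} → Sentence A → Language A → Set
φ Defines L = ∀ w → L w ⇔ w ⊨ φ

FO²Definable : ∀ {A} → Language A → Set
FO²Definable {A} L = Σ[ φ ∈ Sentence A ] φ Defines L

FO²DefinableWithBlocks : ∀ {A} → ℕ → Language A → Set
FO²DefinableWithBlocks {A} n L = Σ[ φ ∈ Sentence A ] (φ Defines L × numBlocks φ ≡ n)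

{-# OPTIONS --safe #-}

-- By induction on the size of the alphabet B, for each d the words over B are covered by finitely
-- many languages of at most |B| blocks, each lying in one class of d-round game equivalence.
-- A word containing all of B factors as u a v where u a is the shortest prefix containing B: u is a
-- word over B ∖ a, and v is peeled in the same way from its right end, and so on alternately.
-- If this stops because a letter is missing, the word is described exactly.  Otherwise, after
-- d + 1 peelings from each side, the remaining core is invisible to d rounds of the game, as every
-- letter can be answered in the outer arches.  Lying between two consecutive peeled positions is a
-- Boolean combination of formulas with a single block (a subword occurs before, or after, x),
-- so relativising the description of u costs only one more block.  A sentence φ of depth d is then
-- the disjunction of the languages whose representative satisfies φ.
module Submission where

open import Data.Nat.Base using (ℕ; zero; suc; _⊔_; _≤_; _<_; _≥_; z≤n; s≤s)
open import Data.Nat.Properties hiding (_≟_)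
open import Data.Fin.Base using (Fin; toℕ; fromℕ<) renaming (zero to 0F; suc to sucF)
import Data.Fin.Properties as Fin
open import Data.Fin.Subset using (Subset; inside; outside) renaming (_∈_ to _∈ᵥ_)
open import Data.Fin.Subset.Properties using () renaming (_∈?_ to _∈ᵥ?_)
open import Data.Vec.Base using (_∷_; []; _[_]≔_; here; there)
open import Data.Vec.Properties.WithK using ([]=-irrelevant)
open import Data.List.Base
  using (List; []; _∷_; _++_; length; map; filter; concatMap; cartesianProductWith; lookup; allFin; foldr)
open import Data.List.Properties using (filter-notAll; length-map; length-tabulate)
open import Data.List.Membership.Propositional using (_∈_; lose; find)
open import Data.List.Membership.Propositional.Properties
  using (∈-map⁺; ∈-++⁺ˡ; ∈-++⁺ʳ; ∈-filter⁺; ∈-filter⁻; ∈-concatMap⁺; ∈-cartesianProductWith⁺;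
         ∈-lookup; ∈-allFin)
open import Data.List.Relation.Unary.All as All using (All; []; _∷_)
import Data.List.Relation.Unary.All.Properties as All
open import Data.List.Relation.Unary.Any as Any using (Any; here; there)
import Data.List.Relation.Unary.Any.Properties as Any
open import Data.Product.Base using (Σ-syntax; ∃-syntax; _×_; _,_; proj₁; proj₂; map₂; swap)
open import Data.Product.Function.NonDependent.Propositional using (_×-⇔_)
open import Data.Sum.Base using (_⊎_; inj₁; inj₂; [_,_]) renaming (map to map⊎)
open import Data.Empty using (⊥; ⊥-elim)
open import Data.Unit.Base using (⊤; tt)
open import Function.Base using (flip; _∘_; id; case_of_)
open import Function.Bundles using (_⇔_; mk⇔; Equivalence; Inverse; _↔_)
open import Function.Construct.Identity using (⇔-id)
open import Function.Properties.Inverse using (↔⇒↣)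
open import Function.Related.TypeIsomorphisms using (¬-cong-⇔)
open import Relation.Binary.Definitions using (DecidableEquality; tri<; tri≈; tri>)
open import Relation.Binary.PropositionalEquality using (_≡_; _≢_; refl; sym; trans; cong; subst)
open import Relation.Nullary using (¬_; Dec; yes; no; ¬?; _×-dec_; _⊎-dec_)
open import Relation.Nullary.Decidable using (toSum; via-injection)
open import Defs
open Equivalence

-- The game on segments

data Side : Set where
  left right : Side

Beyond : Side → ℕ → ℕ → Set
Beyond left  j i = j < i
Beyond right j i = i < j

-- The factor of the ℕ-indexed word label at the positions lo ≤ i < hi.
record Segment (A : Set) : Set where
  constructor _⟨_,_⟩
  field
    label : ℕ → A
    lo hi : ℕ

open Segment

infix 4 _∈ˢ_

_∈ˢ_ : ∀ {A} → ℕ → Segment A → Set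
i ∈ˢ M = lo M ≤ i × i < hi M

Occurs : ∀ {A} → A → Segment A → Set
Occurs a M = ∃[ i ] i ∈ˢ M × label M i ≡ a

Over : ∀ {A} → List A → Segment A → Set
Over B M = ∀ {i} → i ∈ˢ M → label M i ∈ B

-- The answer `j′` is not asked to lie in `N`: the relations put for `R` hold only between positions
-- of the two segments and so ensure it.
Forth : ∀ {A} → (ℕ → ℕ → Set) → Segment A → Segment A → ℕ → ℕ → Set
Forth R M N i j = ∀ s {i′} → i′ ∈ˢ M → Beyond s i′ i → ∃[ j′ ] Beyond s j′ j × R i′ j′

Total : ∀ {A} → (ℕ → ℕ → Set) → Segment A → Set
Total R M = ∀ {i} → i ∈ˢ M → ∃[ j ] R i j

Within : ∀ {A} → Segment A → Segment A → (ℕ → ℕ → Set) → Set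
Within M N R = ∀ {i j} → R i j → i ∈ˢ M × j ∈ˢ N

SameLabel : ∀ {A} → Segment A → Segment A → ℕ → ℕ → Set
SameLabel M N i j = i ∈ˢ M × j ∈ˢ N × label M i ≡ label N j

-- Duplicator wins d more rounds of the two-pebble game on M and N when one pair of pebbles
-- rests on i and j and the other pair is free to be moved.
Bis : ∀ {A} → ℕ → Segment A → Segment A → ℕ → ℕ → Set
Bis zero    M N i j = SameLabel M N i j
Bis (suc d) M N i j =
  SameLabel M N i j × Forth (Bis d M N) M N i j × Forth (flip (Bis d M N)) N M j i

-- An opening move on the empty board precedes the `d` rounds counted by `Bis`.
Eq : ∀ {A} → ℕ → Segment A → Segment A → Set
Eq d M N = Total (Bis d M N) M × Total (flip (Bis d M N)) N

record Step {A} (M N : Segment A) (R R′ : ℕ → ℕ → Set) : Set where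
  field
    forth : ∀ {i j} → R i j → Forth R′ M N i j
    back  : ∀ {i j} → R i j → Forth (flip R′) N M j i

open Step

record Cover {A} (M N : Segment A) (R : ℕ → ℕ → Set) : Set where
  field
    totalˡ : Total R M
    totalʳ : Total (flip R) N

open Cover

infixr 5 _∪_

_∪_ : (R S : ℕ → ℕ → Set) → ℕ → ℕ → Set
(R ∪ S) i j = R i j ⊎ S i j

bis-sameLabel : ∀ {A} d {M N : Segment A} {i j} → Bis d M N i j → SameLabel M N i j
bis-sameLabel zero    b = b
bis-sameLabel (suc d) b = proj₁ b

bis-within : ∀ {A} d {M N : Segment A} → Within M N (Bis d M N)
bis-within d b = let p , q , _ = bis-sameLabel d b in p , q

bis-step : ∀ {A} d {M N : Segment A} → Step M N (Bis (suc d) M N) (Bis d M N)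
bis-step d = record { forth = λ b → proj₁ (proj₂ b) ; back = λ b → proj₂ (proj₂ b) }

forth-map : ∀ {A} {R R′ : ℕ → ℕ → Set} {M N : Segment A} {i j} →
            (∀ {i j} → R i j → R′ i j) → Forth R M N i j → Forth R′ M N i j
forth-map R⇒R′ F s p o = let j′ , o′ , r = F s p o in j′ , o′ , R⇒R′ r

-- The form in which strategies are verified below: label-preserving relations, one for each number
-- of remaining rounds, where every round leads from one to the next.
step-bis : ∀ {A} d {M N : Segment A} {R R′ : ℕ → ℕ → Set} →
           (∀ {i j} → R i j → SameLabel M N i j) → Step M N R R′ →
           (∀ {i j} → R′ i j → Bis d M N i j) → ∀ {i j} → R i j → Bis (suc d) M N i j
step-bis d {M} {N} same step R′⇒Bis r =
  same r , forth-map {M = M} {N} R′⇒Bis (forth step r) , forth-map {M = N} {M} R′⇒Bis (back step r)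

bis-pred : ∀ {A} d {M N : Segment A} {i j} → Bis (suc d) M N i j → Bis d M N i j
bis-pred zero    b = proj₁ b
bis-pred (suc d) = step-bis d proj₁ (bis-step (suc d)) (bis-pred d)

eq-pred : ∀ {A} d {M N : Segment A} → Eq (suc d) M N → Eq d M N
eq-pred d (t , t′) =
  (λ p → map₂ (bis-pred d) (t p)) , (λ p → map₂ (bis-pred d) (t′ p))

bis-≤ : ∀ {A} {d e} {M N : Segment A} → e ≤ d → ∀ {i j} → Bis d M N i j → Bis e M N i j
bis-≤ {d = zero}  z≤n b = b
bis-≤ {d = suc d} {e} le b with m≤n⇒m<n∨m≡n le
... | inj₁ (s≤s e≤d) = bis-≤ e≤d (bis-pred d b)
... | inj₂ refl      = b

cover-bis : ∀ {A} {d e} {M N : Segment A} → e ≤ d → Eq d M N → Cover M N (Bis e M N)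
cover-bis e≤d (t , t′) = record
  { totalˡ = λ p → map₂ (bis-≤ e≤d) (t p) ; totalʳ = λ p → map₂ (bis-≤ e≤d) (t′ p) }

split : ∀ {l r} m {i} → l ≤ i × i < r → (l ≤ i × i < m) ⊎ (m ≤ i × i < r)
split m {i} (p , q) with <-≤-connex i m
... | inj₁ i<m = inj₁ (p , i<m)
... | inj₂ m≤i = inj₂ (m≤i , q)

within-∪ : ∀ {A} {f g : ℕ → A} {l m r l′ m′ r′ R S} → l ≤ m → m ≤ r → l′ ≤ m′ → m′ ≤ r′ →
           Within (f ⟨ l , m ⟩) (g ⟨ l′ , m′ ⟩) R → Within (f ⟨ m , r ⟩) (g ⟨ m′ , r′ ⟩) S →
           Within (f ⟨ l , r ⟩) (g ⟨ l′ , r′ ⟩) (R ∪ S)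
within-∪ c₁ c₂ c₃ c₄ wR wS (inj₁ x) =
  let (p , q) , (p′ , q′) = wR x in (p , <-≤-trans q c₂) , (p′ , <-≤-trans q′ c₄)
within-∪ c₁ c₂ c₃ c₄ wR wS (inj₂ x) =
  let (p , q) , (p′ , q′) = wS x in (≤-trans c₁ p , q) , (≤-trans c₃ p′ , q′)

-- A move within the pebbled half is answered by the strategy of that half. A move across the cut
-- may be answered by any related position of the other half, since that half lies entirely on the
-- required side of the pebble; totality is enough there.
forth-∪ : ∀ {A} {f g : ℕ → A} {l m r l′ m′ r′ R R′ S S′} →
  Within (f ⟨ l , m ⟩) (g ⟨ l′ , m′ ⟩) R → Within (f ⟨ l , m ⟩) (g ⟨ l′ , m′ ⟩) R′ →
  Within (f ⟨ m , r ⟩) (g ⟨ m′ , r′ ⟩) S → Within (f ⟨ m , r ⟩) (g ⟨ m′ , r′ ⟩) S′ →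
  (∀ {i j} → R i j → Forth R′ (f ⟨ l , m ⟩) (g ⟨ l′ , m′ ⟩) i j) → Total R′ (f ⟨ l , m ⟩) →
  (∀ {i j} → S i j → Forth S′ (f ⟨ m , r ⟩) (g ⟨ m′ , r′ ⟩) i j) → Total S′ (f ⟨ m , r ⟩) →
  ∀ {i j} → (R ∪ S) i j → Forth (R′ ∪ S′) (f ⟨ l , r ⟩) (g ⟨ l′ , r′ ⟩) i j
forth-∪ {m = m} wR wR′ wS wS′ fR tR fS tS (inj₁ x) s p o with split m p
... | inj₁ p₁ = let j′ , o′ , y = fR x s p₁ o in j′ , o′ , inj₁ y
forth-∪ wR wR′ wS wS′ fR tR fS tS (inj₁ x) left p o | inj₂ p₂ =
  ⊥-elim (<⇒≱ (<-trans o (proj₂ (proj₁ (wR x)))) (proj₁ p₂))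
forth-∪ wR wR′ wS wS′ fR tR fS tS (inj₁ x) right p o | inj₂ p₂ =
  let j′ , y = tS p₂ in j′ , <-≤-trans (proj₂ (proj₂ (wR x))) (proj₁ (proj₂ (wS′ y))) , inj₂ y
forth-∪ {m = m} wR wR′ wS wS′ fR tR fS tS (inj₂ x) s p o with split m p
... | inj₂ p₂ = let j′ , o′ , y = fS x s p₂ o in j′ , o′ , inj₂ y
forth-∪ wR wR′ wS wS′ fR tR fS tS (inj₂ x) right p o | inj₁ p₁ =
  ⊥-elim (<⇒≱ (<-trans o (proj₂ p₁)) (proj₁ (proj₁ (wS x))))
forth-∪ wR wR′ wS wS′ fR tR fS tS (inj₂ x) left p o | inj₁ p₁ =
  let j′ , y = tR p₁ in j′ , <-≤-trans (proj₂ (proj₂ (wR′ y))) (proj₁ (proj₂ (wS x))) , inj₁ y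

module _ {A : Set} {f g : ℕ → A} {l m r l′ m′ r′ : ℕ} where

  private
    M₁ = f ⟨ l , m ⟩
    M₂ = f ⟨ m , r ⟩
    M  = f ⟨ l , r ⟩
    N₁ = g ⟨ l′ , m′ ⟩
    N₂ = g ⟨ m′ , r′ ⟩
    N  = g ⟨ l′ , r′ ⟩

  step-∪ : ∀ {R R′ S S′} →
    Within M₁ N₁ R → Within M₁ N₁ R′ → Within M₂ N₂ S → Within M₂ N₂ S′ →
    Step M₁ N₁ R R′ → Cover M₁ N₁ R′ → Step M₂ N₂ S S′ → Cover M₂ N₂ S′ →
    Step M N (R ∪ S) (R′ ∪ S′)
  step-∪ {R} {R′} {S} {S′} wR wR′ wS wS′ sR cR sS cS = record
    { forth = forth-∪ {f = f} {g} {R = R} {R′} {S} {S′}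
                wR wR′ wS wS′ (forth sR) (totalˡ cR) (forth sS) (totalˡ cS)
    ; back  = forth-∪ {f = g} {f} {R = flip R} {flip R′} {flip S} {flip S′}
                (swap ∘ wR) (swap ∘ wR′) (swap ∘ wS) (swap ∘ wS′)
                (back sR) (totalʳ cR) (back sS) (totalʳ cS)
    }

  cover-∪ : ∀ {R S} → Cover M₁ N₁ R → Cover M₂ N₂ S → Cover M N (R ∪ S)
  cover-∪ {R} {S} cR cS = record
    { totalˡ = λ p → [ map₂ inj₁ ∘ totalˡ cR , map₂ inj₂ ∘ totalˡ cS ] (split m p)
    ; totalʳ = λ p → [ map₂ inj₁ ∘ totalʳ cR , map₂ inj₂ ∘ totalʳ cS ] (split m′ p)
    }

  module _ (c₁ : l ≤ m) (c₂ : m ≤ r) (c₃ : l′ ≤ m′) (c₄ : m′ ≤ r′) where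

    same-∪ : ∀ d {i j} → (Bis d M₁ N₁ ∪ Bis d M₂ N₂) i j → SameLabel M N i j
    same-∪ d x =
      let p , q = within-∪ {f = f} {g} {R = Bis d M₁ N₁} {Bis d M₂ N₂}
                    c₁ c₂ c₃ c₄ (bis-within d) (bis-within d) x
      in p , q , [ label≡ {M₁} {N₁} , label≡ {M₂} {N₂} ] x
      where
      label≡ : ∀ {K L : Segment A} {i j} → Bis d K L i j → label K i ≡ label L j
      label≡ {K} {L} b = proj₂ (proj₂ (bis-sameLabel d {K} {L} b))

    bis-∪ : ∀ d → Eq d M₁ N₁ → Eq d M₂ N₂ →
            ∀ {i j} → (Bis d M₁ N₁ ∪ Bis d M₂ N₂) i j → Bis d M N i j
    bis-∪ zero    e₁ e₂ = same-∪ zero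
    bis-∪ (suc d) e₁ e₂ = step-bis d (same-∪ (suc d))
      (step-∪ (bis-within (suc d) {M₁} {N₁}) (bis-within d {M₁} {N₁})
         (bis-within (suc d) {M₂} {N₂}) (bis-within d {M₂} {N₂})
         (bis-step d) (cover-bis (n≤1+n d) e₁) (bis-step d) (cover-bis (n≤1+n d) e₂))
      (bis-∪ d (eq-pred d e₁) (eq-pred d e₂))

    -- The strategies for the two halves are played side by side, so game equivalence is a
    -- congruence for concatenation.
    eq-concat : ∀ d → Eq d M₁ N₁ → Eq d M₂ N₂ → Eq d M N
    eq-concat d e₁ e₂ =
      let c = cover-∪ (cover-bis ≤-refl e₁) (cover-bis ≤-refl e₂)
      in map₂ (bis-∪ d e₁ e₂) ∘ totalˡ c , map₂ (bis-∪ d e₁ e₂) ∘ totalʳ c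

eq-singleton : ∀ {A} {f g : ℕ → A} {m m′} d → f m ≡ g m′ → Eq d (f ⟨ m , suc m ⟩) (g ⟨ m′ , suc m′ ⟩)
eq-singleton {f = f} {g} {m} {m′} d same = (λ p → m′ , bis d p) , (λ p → m , bis′ d p)
  where
  only : ∀ {k i} → k ≤ i × i < suc k → i ≡ k
  only (p , s≤s q) = ≤-antisym q p
  apart : ∀ {k i i′} s → k ≤ i × i < suc k → k ≤ i′ × i′ < suc k → ¬ Beyond s i′ i
  apart left  p q o = <-irrefl (trans (only q) (sym (only p))) o
  apart right p q o = <-irrefl (trans (only p) (sym (only q))) o
  here′ : ∀ {k} → k ≤ k × k < suc k
  here′ = ≤-refl , ≤-refl
  bis : ∀ d {i} → m ≤ i × i < suc m → Bis d (f ⟨ m , suc m ⟩) (g ⟨ m′ , suc m′ ⟩) i m′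
  bis d p with only p
  bis zero    p | refl = here′ , here′ , same
  bis (suc d) p | refl = (here′ , here′ , same)
                       , (λ s q o → ⊥-elim (apart s p q o)) , (λ s q o → ⊥-elim (apart s here′ q o))
  bis′ : ∀ d {j} → m′ ≤ j × j < suc m′ → Bis d (f ⟨ m , suc m ⟩) (g ⟨ m′ , suc m′ ⟩) m j
  bis′ d p with only p
  ... | refl = bis d here′

-- Nested blocks around a core

record Block {A} (B : List A) (D : ℕ) (M N : Segment A) : Set where
  field
    equivalent : Eq D M N
    fullˡ : ∀ {b} → b ∈ B → Occurs b M
    fullʳ : ∀ {b} → b ∈ B → Occurs b N

open Block

module _ {A : Set} (B : List A) (D : ℕ) (f g : ℕ → A) where

  -- Pairs of words with t blocks containing all of B on either side of an arbitrary core
  -- (after peeling the leftmost block, if the side is right); corresponding blocks are equivalent.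
  data Nest : Side → ℕ → (l r l′ r′ : ℕ) → Set where
    core   : ∀ {l r l′ r′} → l ≤ r → l′ ≤ r′ → Nest left 0 l r l′ r′
    blockˡ : ∀ {t l m r l′ m′ r′} → l ≤ m → l′ ≤ m′ → Block B D (f ⟨ l , m ⟩) (g ⟨ l′ , m′ ⟩) →
             Nest right (suc t) m r m′ r′ → Nest left (suc t) l r l′ r′
    blockʳ : ∀ {t l m r l′ m′ r′} → m ≤ r → m′ ≤ r′ → Block B D (f ⟨ m , r ⟩) (g ⟨ m′ , r′ ⟩) →
             Nest left t l m l′ m′ → Nest right (suc t) l r l′ r′

module _ {A : Set} {B : List A} {D : ℕ} {f g : ℕ → A} where

  nest-≤ : ∀ {s t l r l′ r′} → Nest B D f g s t l r l′ r′ → l ≤ r × l′ ≤ r′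
  nest-≤ (core p q)         = p , q
  nest-≤ (blockˡ p q _ N)   = let p′ , q′ = nest-≤ N in ≤-trans p p′ , ≤-trans q q′
  nest-≤ (blockʳ p q _ N)   = let p′ , q′ = nest-≤ N in ≤-trans p′ p , ≤-trans q′ q

  -- Positions in the outermost k blocks must correspond; inside, only the labels must agree.
  Matched : ∀ {t l r l′ r′} → Nest B D f g left t l r l′ r′ → (k e : ℕ) → ℕ → ℕ → Set
  Matched {l = l} {r} {l′} {r′} _ zero e = SameLabel (f ⟨ l , r ⟩) (g ⟨ l′ , r′ ⟩)
  -- No block is left to match. The lemmas on covers and steps assume `k < t`, which keeps this case
  -- out of reach.
  Matched (core _ _) (suc k) e i j = ⊥
  Matched {l = l} {r} {l′} {r′} (blockˡ {m = m} {m′ = m′} _ _ _ (blockʳ {m = n} {m′ = n′} _ _ _ N))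
    (suc k) e =
    Bis e (f ⟨ l , m ⟩) (g ⟨ l′ , m′ ⟩) ∪ Matched N k e ∪ Bis e (f ⟨ n , r ⟩) (g ⟨ n′ , r′ ⟩)

  matched-same : ∀ {t l r l′ r′} (N : Nest B D f g left t l r l′ r′) k e {i j} →
                 Matched N k e i j → SameLabel (f ⟨ l , r ⟩) (g ⟨ l′ , r′ ⟩) i j
  matched-same N zero e x = x
  matched-same (core _ _) (suc k) e ()
  matched-same (blockˡ p q U (blockʳ p′ q′ V N)) (suc k) e (inj₁ x) =
    let (a , b) , (a′ , b′) , same = bis-sameLabel e x ; n , n′ = nest-≤ N
    in (a , <-≤-trans b (≤-trans n p′)) , (a′ , <-≤-trans b′ (≤-trans n′ q′)) , same
  matched-same (blockˡ p q U (blockʳ p′ q′ V N)) (suc k) e (inj₂ (inj₁ x)) =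
    let (a , b) , (a′ , b′) , same = matched-same N k e x
    in (≤-trans p a , <-≤-trans b p′) , (≤-trans q a′ , <-≤-trans b′ q′) , same
  matched-same (blockˡ p q U (blockʳ p′ q′ V N)) (suc k) e (inj₂ (inj₂ x)) =
    let (a , b) , (a′ , b′) , same = bis-sameLabel e x ; n , n′ = nest-≤ N
    in (≤-trans (≤-trans p n) a , b) , (≤-trans (≤-trans q n′) a′ , b′) , same

  matched-within : ∀ {t l r l′ r′} (N : Nest B D f g left t l r l′ r′) k e →
                   Within (f ⟨ l , r ⟩) (g ⟨ l′ , r′ ⟩) (Matched N k e)
  matched-within N k e x = let p , q , _ = matched-same N k e x in p , q

-- A move out of the pebbled outer block, or from inside, is answered in the outer block in that direction.
forth-enclosed : ∀ {A} {f g : ℕ → A} {l m n r l′ m′ n′ r′} {R : ℕ → ℕ → Set} →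
  l ≤ m → m ≤ n → n ≤ r → l′ ≤ m′ → m′ ≤ n′ → n′ ≤ r′ →
  (∀ {i} → i ∈ˢ f ⟨ l , r ⟩ → ∃[ j ] j ∈ˢ g ⟨ l′ , m′ ⟩ × R i j) →
  (∀ {i} → i ∈ˢ f ⟨ l , r ⟩ → ∃[ j ] j ∈ˢ g ⟨ n′ , r′ ⟩ × R i j) →
  ∀ {i j} →
  (i ∈ˢ f ⟨ l , m ⟩ × j ∈ˢ g ⟨ l′ , m′ ⟩ × Forth R (f ⟨ l , m ⟩) (g ⟨ l′ , m′ ⟩) i j) ⊎
  (i ∈ˢ f ⟨ m , n ⟩ × j ∈ˢ g ⟨ m′ , n′ ⟩) ⊎
  (i ∈ˢ f ⟨ n , r ⟩ × j ∈ˢ g ⟨ n′ , r′ ⟩ × Forth R (f ⟨ n , r ⟩) (g ⟨ n′ , r′ ⟩) i j) →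
  Forth R (f ⟨ l , r ⟩) (g ⟨ l′ , r′ ⟩) i j
forth-enclosed c₁ c₂ c₃ c₄ c₅ c₆ pickˡ pickʳ (inj₁ (p , q , F)) left  (a , b) o =
  F left (a , <-trans o (proj₂ p)) o
forth-enclosed c₁ c₂ c₃ c₄ c₅ c₆ pickˡ pickʳ (inj₁ (p , q , F)) right i′∈ o =
  let j′ , (a , _) , x = pickʳ i′∈ in j′ , <-≤-trans (proj₂ q) (≤-trans c₅ a) , x
forth-enclosed c₁ c₂ c₃ c₄ c₅ c₆ pickˡ pickʳ (inj₂ (inj₁ (p , q))) left  i′∈ o =
  let j′ , (_ , b) , x = pickˡ i′∈ in j′ , <-≤-trans b (proj₁ q) , x
forth-enclosed c₁ c₂ c₃ c₄ c₅ c₆ pickˡ pickʳ (inj₂ (inj₁ (p , q))) right i′∈ o =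
  let j′ , (a , _) , x = pickʳ i′∈ in j′ , <-≤-trans (proj₂ q) a , x
forth-enclosed c₁ c₂ c₃ c₄ c₅ c₆ pickˡ pickʳ (inj₂ (inj₂ (p , q , F))) left  i′∈ o =
  let j′ , (_ , b) , x = pickˡ i′∈ in j′ , <-≤-trans b (≤-trans c₅ (proj₁ q)) , x
forth-enclosed c₁ c₂ c₃ c₄ c₅ c₆ pickˡ pickʳ (inj₂ (inj₂ (p , q , F))) right (a , b) o =
  F right (≤-trans (proj₁ p) (<⇒≤ o) , b) o

same-sym : ∀ {A} {M N : Segment A} {i j} → SameLabel M N i j → SameLabel N M j i
same-sym (i∈ , j∈ , same) = j∈ , i∈ , sym same

over-⊆ : ∀ {A} {B : List A} {f : ℕ → A} {l l′ r r′} → l ≤ l′ → r′ ≤ r →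
         Over B (f ⟨ l , r ⟩) → Over B (f ⟨ l′ , r′ ⟩)
over-⊆ p q over (a , b) = over (≤-trans p a , <-≤-trans b q)

module _ {A : Set} {B : List A} {D : ℕ} {f g : ℕ → A} where

  -- A target that contains every letter of `B` holds an equally labelled position for each move;
  -- choosing the target fixes the direction of the answer.
  pick : ∀ {M N : Segment A} {l r} → l ≤ lo N → hi N ≤ r →
         Over B M → (∀ {b} → b ∈ B → Occurs b N) →
         ∀ {i} → i ∈ˢ M → ∃[ j ] j ∈ˢ N × SameLabel M (label N ⟨ l , r ⟩) i j
  pick p q over full i∈ =
    let j , j∈ , same = full (over i∈)
    in j , j∈ , i∈ , (≤-trans p (proj₁ j∈) , <-≤-trans (proj₂ j∈) q) , sym same

  -- As `k < t`, a further block lies inside the `k` outermost pairs. It contains all of `B`, so it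
  -- offers an equally labelled answer to every position that those pairs enclose.
  cover-matched : ∀ {t l r l′ r′} (N : Nest B D f g left t l r l′ r′) →
    Over B (f ⟨ l , r ⟩) → Over B (g ⟨ l′ , r′ ⟩) →
    ∀ {k e} → e ≤ D → k < t → Cover (f ⟨ l , r ⟩) (g ⟨ l′ , r′ ⟩) (Matched N k e)
  cover-matched {l = l} {r} {l′} {r′} (blockˡ {m = m} {m′ = m′} p q U N) oM oN {zero} le lt = record
    { totalˡ = λ i∈ → let j , _ , x = pick {M} {g ⟨ l′ , m′ ⟩} ≤-refl m′≤r′ oM (fullʳ U) i∈
                      in j , x
    ; totalʳ = λ j∈ → let i , _ , x = pick {M′} {f ⟨ l , m ⟩} ≤-refl m≤r oN (fullˡ U) j∈
                      in i , same-sym {M = M′} {M} x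
    }
    where
    M    = f ⟨ l , r ⟩
    M′   = g ⟨ l′ , r′ ⟩
    m≤r   = proj₁ (nest-≤ N)
    m′≤r′ = proj₂ (nest-≤ N)
  cover-matched (blockˡ p q U (blockʳ p′ q′ V N)) oM oN {suc k} le (s≤s lt) =
    cover-∪ (cover-bis le (equivalent U))
      (cover-∪ (cover-matched N (over-⊆ p p′ oM) (over-⊆ q q′ oN) le lt) (cover-bis le (equivalent V)))

  -- A round costs one pair of blocks. When a single pair is left to give up, a move that stays in
  -- the pebbled block is answered by the game on that block, and other moves are answered by label
  -- in the outer block lying in the direction of the move. With more pairs left, the strategies of
  -- the two outer blocks and of the inner nest are combined as for a concatenation.
  step-matched : ∀ {t l r l′ r′} (N : Nest B D f g left t l r l′ r′) →
    Over B (f ⟨ l , r ⟩) → Over B (g ⟨ l′ , r′ ⟩) →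
    ∀ {k e} → e ≤ D → k < t →
    Step (f ⟨ l , r ⟩) (g ⟨ l′ , r′ ⟩) (Matched N (suc k) (suc e)) (Matched N k e)
  step-matched {l = l} {r} {l′} {r′} (blockˡ {m = m} {m′ = m′} p q U (blockʳ {m = n} {m′ = n′} p′ q′ V N))
    oM oN {zero} {e} le lt = record
    { forth = λ x → forth-enclosed {f = f} {g} p m≤n p′ q m′≤n′ q′
        (pick {M} {g ⟨ l′ , m′ ⟩} ≤-refl (≤-trans m′≤n′ q′) oM (fullʳ U))
        (pick {M} {g ⟨ n′ , r′ ⟩} (≤-trans q m′≤n′) ≤-refl oM (fullʳ V))
        (map⊎
          (λ b → let i∈ , j∈ = bis-within (suc e) b in i∈ , j∈ , λ s i′∈ o →
            map₂ (map₂ sameU) (forth (bis-step e) b s i′∈ o))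
          (map⊎ (λ (i∈ , j∈ , _) → i∈ , j∈)
            (λ b → let i∈ , j∈ = bis-within (suc e) b in i∈ , j∈ , λ s i′∈ o →
              map₂ (map₂ sameV) (forth (bis-step e) b s i′∈ o))) x)
    ; back  = λ x → forth-enclosed {f = g} {f} q m′≤n′ q′ p m≤n p′
        (map₂ (map₂ (same-sym {M = M′} {M})) ∘
          pick {M′} {f ⟨ l , m ⟩} ≤-refl (≤-trans m≤n p′) oN (fullˡ U))
        (map₂ (map₂ (same-sym {M = M′} {M})) ∘
          pick {M′} {f ⟨ n , r ⟩} (≤-trans p m≤n) ≤-refl oN (fullˡ V))
        (map⊎
          (λ b → let i∈ , j∈ = bis-within (suc e) b in j∈ , i∈ , λ s i′∈ o →
            map₂ (map₂ sameU) (back (bis-step e) b s i′∈ o))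
          (map⊎ (λ (i∈ , j∈ , _) → j∈ , i∈)
            (λ b → let i∈ , j∈ = bis-within (suc e) b in j∈ , i∈ , λ s i′∈ o →
              map₂ (map₂ sameV) (back (bis-step e) b s i′∈ o))) x)
    }
    where
    M     = f ⟨ l , r ⟩
    M′    = g ⟨ l′ , r′ ⟩
    m≤n   = proj₁ (nest-≤ N)
    m′≤n′ = proj₂ (nest-≤ N)
    sameU : ∀ {i j} → Bis e (f ⟨ l , m ⟩) (g ⟨ l′ , m′ ⟩) i j → SameLabel M M′ i j
    sameU y = matched-same (blockˡ p q U (blockʳ p′ q′ V N)) 1 e (inj₁ y)
    sameV : ∀ {i j} → Bis e (f ⟨ n , r ⟩) (g ⟨ n′ , r′ ⟩) i j → SameLabel M M′ i j
    sameV y = matched-same (blockˡ p q U (blockʳ p′ q′ V N)) 1 e (inj₂ (inj₂ y))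
  step-matched {r = r} {r′ = r′} (blockˡ {m = m} {m′ = m′} p q U (blockʳ {m = n} {m′ = n′} p′ q′ V N))
    oM oN {suc k} {e} le (s≤s lt) =
    step-∪ (bis-within (suc e)) (bis-within e) (within (suc k) (suc e)) (within k e)
      (bis-step e) (cover-bis le (equivalent U))
      (step-∪ (matched-within N (suc k) (suc e)) (matched-within N k e) (bis-within (suc e)) (bis-within e)
        (step-matched N oM′ oN′ le lt) cN (bis-step e) cV)
      (cover-∪ cN cV)
    where
    oM′ = over-⊆ {f = f} p p′ oM
    oN′ = over-⊆ {f = g} q q′ oN
    cN = cover-matched N oM′ oN′ le lt
    cV = cover-bis le (equivalent V)
    within : ∀ k e → Within (f ⟨ m , r ⟩) (g ⟨ m′ , r′ ⟩)
                       (Matched N k e ∪ Bis e (f ⟨ n , r ⟩) (g ⟨ n′ , r′ ⟩))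
    within k e = within-∪ {f = f} {g} (proj₁ (nest-≤ N)) p′ (proj₂ (nest-≤ N)) q′
                   (matched-within N k e) (bis-within e)

  nest-bis : ∀ {t l r l′ r′} (N : Nest B D f g left t l r l′ r′) →
    Over B (f ⟨ l , r ⟩) → Over B (g ⟨ l′ , r′ ⟩) →
    ∀ e → e ≤ D → e < t → ∀ {i j} → Matched N e e i j → Bis e (f ⟨ l , r ⟩) (g ⟨ l′ , r′ ⟩) i j
  nest-bis N oM oN zero    le lt = id
  nest-bis N oM oN (suc e) le lt = step-bis e (matched-same N (suc e) (suc e))
    (step-matched N oM oN (<⇒≤ le) (<⇒≤ lt)) (nest-bis N oM oN e (<⇒≤ le) (<⇒≤ lt))

  -- Each of the `D` rounds gives up one pair of blocks, and one more pair is needed to answer an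
  -- opening move into the part enclosed by the other `D`; hence `suc D`.
  eq-nest : ∀ {l r l′ r′} → Nest B D f g left (suc D) l r l′ r′ →
    Over B (f ⟨ l , r ⟩) → Over B (g ⟨ l′ , r′ ⟩) → Eq D (f ⟨ l , r ⟩) (g ⟨ l′ , r′ ⟩)
  eq-nest N oM oN =
    let c = cover-matched N oM oN ≤-refl ≤-refl ; bis = nest-bis N oM oN D ≤-refl ≤-refl
    in (λ p → map₂ bis (totalˡ c p)) , (λ p → map₂ bis (totalʳ c p))

-- Occurrences

occurs-⊆ : ∀ {A a} {f : ℕ → A} {l l′ r r′} → l ≤ l′ → r′ ≤ r →
           Occurs a (f ⟨ l′ , r′ ⟩) → Occurs a (f ⟨ l , r ⟩)
occurs-⊆ p q (i , (a , b) , same) = i , (≤-trans p a , <-≤-trans b q) , same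

First Last : ∀ {A} → A → Segment A → ℕ → Set
First a (f ⟨ l , r ⟩) m = m ∈ˢ f ⟨ l , r ⟩ × f m ≡ a × ¬ Occurs a (f ⟨ l , m ⟩)
Last  a (f ⟨ l , r ⟩) m = m ∈ˢ f ⟨ l , r ⟩ × f m ≡ a × ¬ Occurs a (f ⟨ suc m , r ⟩)

module _ {A : Set} (_≟_ : DecidableEquality A) where

  first? : ∀ a (f : ℕ → A) l r → (∃[ m ] First a (f ⟨ l , r ⟩) m) ⊎ ¬ Occurs a (f ⟨ l , r ⟩)
  first? a f l zero = inj₂ λ ()
  first? a f l (suc r) with first? a f l r
  ... | inj₁ (m , (p , q) , first) = inj₁ (m , (p , m≤n⇒m≤1+n q) , first)
  ... | inj₂ none with l ≤? r | f r ≟ a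
  ...   | yes l≤r | yes fr≡a = inj₁ (r , (l≤r , ≤-refl) , fr≡a , none)
  ...   | no l≰r  | _        = inj₂ λ { (i , (p , s≤s q) , _) → l≰r (≤-trans p q) }
  ...   | yes _   | no fr≢a  = inj₂ λ { (i , (p , s≤s q) , fi≡a) →
    [ (λ i<r → none (i , (p , i<r) , fi≡a)) , (λ { refl → fr≢a fi≡a }) ] (m≤n⇒m<n∨m≡n q) }

  last? : ∀ a (f : ℕ → A) l r → (∃[ m ] Last a (f ⟨ l , r ⟩) m) ⊎ ¬ Occurs a (f ⟨ l , r ⟩)
  last? a f l zero = inj₂ λ ()
  last? a f l (suc r) with l ≤? r | f r ≟ a
  ... | yes l≤r | yes fr≡a = inj₁ (r , (l≤r , ≤-refl) , fr≡a , λ { (i , (p , q) , _) → <⇒≱ q p })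
  ... | no l≰r  | _        = inj₂ λ { (i , (p , s≤s q) , _) → l≰r (≤-trans p q) }
  ... | yes _   | no fr≢a with last? a f l r
  ...   | inj₁ (m , (p , q) , fm≡a , none) = inj₁ (m , (p , m≤n⇒m≤1+n q) , fm≡a ,
    λ { (i , (p , s≤s q) , fi≡a) →
    [ (λ i<r → none (i , (p , i<r) , fi≡a)) , (λ { refl → fr≢a fi≡a }) ] (m≤n⇒m<n∨m≡n q) })
  ...   | inj₂ none = inj₂ λ { (i , (p , s≤s q) , fi≡a) →
    [ (λ i<r → none (i , (p , i<r) , fi≡a)) , (λ { refl → fr≢a fi≡a }) ] (m≤n⇒m<n∨m≡n q) }

  first : ∀ {a} {f : ℕ → A} {l r} → Occurs a (f ⟨ l , r ⟩) → ∃[ m ] First a (f ⟨ l , r ⟩) m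
  first {a} {f} {l} {r} o = [ id , (λ none → ⊥-elim (none o)) ] (first? a f l r)

  last : ∀ {a} {f : ℕ → A} {l r} → Occurs a (f ⟨ l , r ⟩) → ∃[ m ] Last a (f ⟨ l , r ⟩) m
  last {a} {f} {l} {r} o = [ id , (λ none → ⊥-elim (none o)) ] (last? a f l r)

  missing? : ∀ (B : List A) f l r →
             (∃[ b ] b ∈ B × ¬ Occurs b (f ⟨ l , r ⟩)) ⊎ (∀ {b} → b ∈ B → Occurs b (f ⟨ l , r ⟩))
  missing? []      f l r = inj₂ λ ()
  missing? (b ∷ B) f l r with first? b f l r | missing? B f l r
  ... | inj₂ none           | _                       = inj₁ (b , here refl , none)
  ... | inj₁ _              | inj₁ (c , c∈B , none)   = inj₁ (c , there c∈B , none)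
  ... | inj₁ (m , m∈ , same , _) | inj₂ full = inj₂ λ { (here refl) → m , m∈ , same ; (there c∈B) → full c∈B }

  -- The letter whose first occurrence comes last completes the shortest prefix containing every letter.
  last-first : ∀ {b} {B : List A} {f l r} → (∀ {c} → c ∈ b ∷ B → Occurs c (f ⟨ l , r ⟩)) →
               ∃[ a ] ∃[ m ] a ∈ b ∷ B × First a (f ⟨ l , r ⟩) m ×
               (∀ {c} → c ∈ b ∷ B → Occurs c (f ⟨ l , suc m ⟩))
  last-first {b} {[]} full =
    let m , (p , q) , same , none = first (full (here refl))
    in b , m , here refl , ((p , q) , same , none) , λ { (here refl) → m , (p , ≤-refl) , same }
  last-first {b} {b′ ∷ B} full with first (full (here refl)) | last-first {b′} {B} (full ∘ there)
  ... | n , (p′ , q′) , same′ , none′ | a , m , a∈ , ((p , q) , same , none) , rest with ≤-total m n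
  ...   | inj₁ m≤n = b , n , here refl , ((p′ , q′) , same′ , none′) ,
    λ { (here refl) → n , (p′ , ≤-refl) , same′ ; (there c∈) → occurs-⊆ ≤-refl (s≤s m≤n) (rest c∈) }
  ...   | inj₂ n≤m = a , m , there a∈ , ((p , q) , same , none) ,
    λ { (here refl) → n , (p′ , s≤s n≤m) , same′ ; (there c∈) → rest c∈ }

  first-last : ∀ {b} {B : List A} {f l r} → (∀ {c} → c ∈ b ∷ B → Occurs c (f ⟨ l , r ⟩)) →
               ∃[ a ] ∃[ m ] a ∈ b ∷ B × Last a (f ⟨ l , r ⟩) m ×
               (∀ {c} → c ∈ b ∷ B → Occurs c (f ⟨ m , r ⟩))
  first-last {b} {[]} full =
    let m , (p , q) , same , none = last (full (here refl))
    in b , m , here refl , ((p , q) , same , none) , λ { (here refl) → m , (≤-refl , q) , same }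
  first-last {b} {b′ ∷ B} full with last (full (here refl)) | first-last {b′} {B} (full ∘ there)
  ... | n , (p′ , q′) , same′ , none′ | a , m , a∈ , ((p , q) , same , none) , rest with ≤-total n m
  ...   | inj₁ n≤m = b , n , here refl , ((p′ , q′) , same′ , none′) ,
    λ { (here refl) → n , (≤-refl , q′) , same′ ; (there c∈) → occurs-⊆ n≤m ≤-refl (rest c∈) }
  ...   | inj₂ m≤n = a , m , there a∈ , ((p , q) , same , none) ,
    λ { (here refl) → n , (m≤n , q′) , same′ ; (there c∈) → rest c∈ }

-- A word may be laid out at any offset of any labelling, so a factor of a concatenation is just a
-- subinterval and no position is ever renumbered.
data Spells {A : Set} (g : ℕ → A) : ℕ → List A → ℕ → Set where
  []  : ∀ {l} → Spells g l [] l
  _∷_ : ∀ {l r a u} → g l ≡ a → Spells g (suc l) u r → Spells g l (a ∷ u) r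

module _ {A : Set} {g : ℕ → A} where

  spells-≤ : ∀ {l r u} → Spells g l u r → l ≤ r
  spells-≤ []      = ≤-refl
  spells-≤ (_ ∷ s) = <⇒≤ (spells-≤ s)

  spells-++ : ∀ {l r} u {v} → Spells g l (u ++ v) r → ∃[ m ] Spells g l u m × Spells g m v r
  spells-++ []      s       = _ , [] , s
  spells-++ (a ∷ u) (e ∷ s) = let m , s₁ , s₂ = spells-++ u s in m , e ∷ s₁ , s₂

  spells-over : ∀ {l r u} → Spells g l u r → Over u (g ⟨ l , r ⟩)
  spells-over []      (p , q) = ⊥-elim (<⇒≱ q p)
  spells-over (e ∷ s) (p , q) with m≤n⇒m<n∨m≡n p
  ... | inj₁ l<i  = there (spells-over s (l<i , q))
  ... | inj₂ refl = here e

  spells-occurs : ∀ {l r u b} → Spells g l u r → b ∈ u → Occurs b (g ⟨ l , r ⟩)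
  spells-occurs (e ∷ s) (here refl) = _ , (≤-refl , spells-≤ s) , e
  spells-occurs (e ∷ s) (there b∈u) = occurs-⊆ (n≤1+n _) ≤-refl (spells-occurs s b∈u)

-- Segments carry total labellings; the default letter appears only past the end of the word,
-- outside its segment.
letterAt : ∀ {A : Set} → A → List A → ℕ → A
letterAt d []      i       = d
letterAt d (a ∷ w) zero    = a
letterAt d (a ∷ w) (suc i) = letterAt d w i

spells-letterAt : ∀ {A} (d : A) w → Spells (letterAt d w) 0 w (length w)
spells-letterAt d []      = []
spells-letterAt d (a ∷ w) = refl ∷ shift (spells-letterAt d w)
  where
  shift : ∀ {l r u} → Spells (letterAt d w) l u r → Spells (letterAt d (a ∷ w)) (suc l) u (suc r)
  shift []      = []
  shift (e ∷ s) = e ∷ shift s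

-- Unary temporal logic

infixr 6 _∧ᵘ_ _∧ˢ_
infix  7 ¬ᵘ_ ¬ˢ_

-- `some left` and `some right` are the strict past and strict future modalities.
data Unary (A : Set) : Set where
  ⊤ᵘ   : Unary A
  is   : A → Unary A
  ¬ᵘ_  : Unary A → Unary A
  _∧ᵘ_ : Unary A → Unary A → Unary A
  some : Side → Unary A → Unary A

data Closed (A : Set) : Set where
  ⊤ˢ    : Closed A
  ¬ˢ_   : Closed A → Closed A
  _∧ˢ_  : Closed A → Closed A → Closed A
  exist : Unary A → Closed A

Holds : ∀ {A} → Segment A → ℕ → Unary A → Set
Holds M i ⊤ᵘ         = ⊤
Holds M i (is a)     = label M i ≡ a
Holds M i (¬ᵘ α)     = ¬ Holds M i α
Holds M i (α ∧ᵘ β)   = Holds M i α × Holds M i β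
Holds M i (some s α) = ∃[ j ] j ∈ˢ M × Beyond s j i × Holds M j α

True : ∀ {A} → Segment A → Closed A → Set
True M ⊤ˢ        = ⊤
True M (¬ˢ φ)    = ¬ True M φ
True M (φ ∧ˢ ψ)  = True M φ × True M ψ
True M (exist α) = ∃[ i ] i ∈ˢ M × Holds M i α

dual : Quantifier → Quantifier
dual ex  = all
dual all = ex

-- The number of blocks met below a quantifier q, not counting those merged with q.
rankᵘ : ∀ {A} → Quantifier → Unary A → ℕ
rankᵘ q   ⊤ᵘ         = 0
rankᵘ q   (is a)     = 0
rankᵘ q   (¬ᵘ α)     = rankᵘ (dual q) α
rankᵘ q   (α ∧ᵘ β)   = rankᵘ q α ⊔ rankᵘ q β
rankᵘ ex  (some s α) = rankᵘ ex α
rankᵘ all (some s α) = suc (rankᵘ ex α)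

rankˢ : ∀ {A} → Closed A → ℕ
rankˢ ⊤ˢ        = 0
rankˢ (¬ˢ φ)    = rankˢ φ
rankˢ (φ ∧ˢ ψ)  = rankˢ φ ⊔ rankˢ ψ
rankˢ (exist α) = suc (rankᵘ ex α)

-- Relativisation to an interval

relᵘ : ∀ {A} → Unary A → Unary A → Unary A
relᵘ θ ⊤ᵘ         = ⊤ᵘ
relᵘ θ (is a)     = is a
relᵘ θ (¬ᵘ α)     = ¬ᵘ relᵘ θ α
relᵘ θ (α ∧ᵘ β)   = relᵘ θ α ∧ᵘ relᵘ θ β
relᵘ θ (some s α) = some s (θ ∧ᵘ relᵘ θ α)

relˢ : ∀ {A} → Unary A → Closed A → Closed A
relˢ θ ⊤ˢ        = ⊤ˢ
relˢ θ (¬ˢ φ)    = ¬ˢ relˢ θ φ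
relˢ θ (φ ∧ˢ ψ)  = relˢ θ φ ∧ˢ relˢ θ ψ
relˢ θ (exist α) = exist (θ ∧ᵘ relᵘ θ α)

module _ {A : Set} {θ : Unary A} (θ≤1 : ∀ q → rankᵘ q θ ≤ 1) where

  -- The guards do not nest: each copy of `θ` hangs on a branch of its own and lengthens only that
  -- branch, by at most one block. The other branches keep their blocks.
  rankᵘ-rel : ∀ q α → rankᵘ q (relᵘ θ α) ≤ suc (rankᵘ q α)
  rankᵘ-rel q   ⊤ᵘ         = z≤n
  rankᵘ-rel q   (is a)     = z≤n
  rankᵘ-rel q   (¬ᵘ α)     = rankᵘ-rel (dual q) α
  rankᵘ-rel q   (α ∧ᵘ β)   = ⊔-mono-≤ (rankᵘ-rel q α) (rankᵘ-rel q β)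
  rankᵘ-rel ex  (some s α) = ⊔-lub (≤-trans (θ≤1 ex) (s≤s z≤n)) (rankᵘ-rel ex α)
  rankᵘ-rel all (some s α) = s≤s (⊔-lub (≤-trans (θ≤1 ex) (s≤s z≤n)) (rankᵘ-rel ex α))

  rankˢ-rel : ∀ φ → rankˢ (relˢ θ φ) ≤ suc (rankˢ φ)
  rankˢ-rel ⊤ˢ        = z≤n
  rankˢ-rel (¬ˢ φ)    = rankˢ-rel φ
  rankˢ-rel (φ ∧ˢ ψ)  = ⊔-mono-≤ (rankˢ-rel φ) (rankˢ-rel ψ)
  rankˢ-rel (exist α) = s≤s (⊔-lub (≤-trans (θ≤1 ex) (s≤s z≤n)) (rankᵘ-rel ex α))

module _ {A : Set} {f : ℕ → A} {L R l r : ℕ} (L≤l : L ≤ l) (r≤R : r ≤ R) (θ : Unary A)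
         (θ⇔ : ∀ {x} → x ∈ˢ f ⟨ L , R ⟩ → Holds (f ⟨ L , R ⟩) x θ ⇔ x ∈ˢ f ⟨ l , r ⟩) where

  private
    widen : ∀ {x} → x ∈ˢ f ⟨ l , r ⟩ → x ∈ˢ f ⟨ L , R ⟩
    widen (p , q) = ≤-trans L≤l p , <-≤-trans q r≤R

  holds-rel : ∀ α {x} → Holds (f ⟨ L , R ⟩) x (relᵘ θ α) ⇔ Holds (f ⟨ l , r ⟩) x α
  holds-rel ⊤ᵘ         = ⇔-id _
  holds-rel (is a)     = ⇔-id _
  holds-rel (¬ᵘ α)     = ¬-cong-⇔ (holds-rel α)
  holds-rel (α ∧ᵘ β)   = holds-rel α ×-⇔ holds-rel β
  holds-rel (some s α) = mk⇔
    (λ (j , j∈ , o , t , h) → j , to (θ⇔ j∈) t , o , to (holds-rel α) h)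
    (λ (j , j∈ , o , h) → j , widen j∈ , o , from (θ⇔ (widen j∈)) j∈ , from (holds-rel α) h)

  true-rel : ∀ φ → True (f ⟨ L , R ⟩) (relˢ θ φ) ⇔ True (f ⟨ l , r ⟩) φ
  true-rel ⊤ˢ        = ⇔-id _
  true-rel (¬ˢ φ)    = ¬-cong-⇔ (true-rel φ)
  true-rel (φ ∧ˢ ψ)  = true-rel φ ×-⇔ true-rel ψ
  true-rel (exist α) = mk⇔
    (λ (j , j∈ , t , h) → j , to (θ⇔ j∈) t , to (holds-rel α) h)
    (λ (j , j∈ , h) → j , widen j∈ , from (θ⇔ (widen j∈)) j∈ , from (holds-rel α) h)

-- chain s as holds at x iff as, read from the last letter to the first if s = left
-- and from the first to the last if s = right, is a subword of the part of the word beyond x.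
chain : ∀ {A} → Side → List A → Unary A
chain s []       = ⊤ᵘ
chain s (a ∷ as) = some s (is a ∧ᵘ chain s as)

-- The modalities are nested without negation, so they all merge with the existential quantifier
-- above them.
rank-chain-ex : ∀ {A} s (as : List A) → rankᵘ ex (chain s as) ≤ 0
rank-chain-ex s []       = z≤n
rank-chain-ex s (a ∷ as) = rank-chain-ex s as

rank-chain : ∀ {A} s (as : List A) q → rankᵘ q (chain s as) ≤ 1
rank-chain s as       ex  = ≤-trans (rank-chain-ex s as) z≤n
rank-chain s []       all = z≤n
rank-chain s (a ∷ as) all = s≤s (rank-chain-ex s as)

beyond-trans : ∀ s {i j k} → Beyond s i j → Beyond s j k → Beyond s i k
beyond-trans left  p q = <-trans p q
beyond-trans right p q = <-trans q p

beyond-irrefl : ∀ s {i} → ¬ Beyond s i i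
beyond-irrefl left  = <-irrefl refl
beyond-irrefl right = <-irrefl refl

beyond-cmp : ∀ s i j → Beyond s i j ⊎ i ≡ j ⊎ Beyond s j i
beyond-cmp left i j with <-cmp i j
... | tri< p _ _ = inj₁ p
... | tri≈ _ p _ = inj₂ (inj₁ p)
... | tri> _ _ p = inj₂ (inj₂ p)
beyond-cmp right i j with <-cmp i j
... | tri< p _ _ = inj₂ (inj₂ p)
... | tri≈ _ p _ = inj₂ (inj₁ p)
... | tri> _ _ p = inj₁ p

-- Defines the factor cut off by the next peeling. If `m` is the nearest `a` beyond the positions
-- already peeled from side `s`, failure of the longer chain means not being past `m`, and `m`
-- itself is excluded by its label. Only chains are combined, which keeps the guard at one block.
upTo : ∀ {A} → Side → A → List A → Unary A
upTo s a as = chain s as ∧ᵘ ¬ᵘ chain s (a ∷ as) ∧ᵘ ¬ᵘ is a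

rank-upTo : ∀ {A} s a (as : List A) q → rankᵘ q (upTo s a as) ≤ 1
rank-upTo s a as q = ⊔-lub (rank-chain s as q) (⊔-lub (rank-chain s (a ∷ as) (dual q)) z≤n)

module _ {A : Set} (M : Segment A) (s : Side) (a : A) (as : List A) (P : ℕ → Set) {m : ℕ}
         (chain⇔ : ∀ {x} → x ∈ˢ M → Holds M x (chain s as) ⇔ P x)
         (m∈ : m ∈ˢ M) (Pm : P m) (same : label M m ≡ a)
         (none : ∀ {j} → P j → Beyond s j m → label M j ≢ a) where

  -- Among the `a`-positions in `P`, `m` is extreme: it serves as witness wherever any of them does.
  chain-∷ : ∀ {x} → x ∈ˢ M → Holds M x (chain s (a ∷ as)) ⇔ Beyond s m x
  chain-∷ {x} x∈ = mk⇔ fwd (λ o → m , m∈ , o , same , from (chain⇔ m∈) Pm)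
    where
    fwd : Holds M x (chain s (a ∷ as)) → Beyond s m x
    fwd (j , j∈ , o , e , h) with beyond-cmp s j m
    ... | inj₁ j<m         = ⊥-elim (none (to (chain⇔ j∈) h) j<m e)
    ... | inj₂ (inj₁ refl) = o
    ... | inj₂ (inj₂ m<j)  = beyond-trans s m<j o

  upTo⇔ : ∀ {x} → x ∈ˢ M → Holds M x (upTo s a as) ⇔ (P x × Beyond s x m)
  upTo⇔ {x} x∈ = mk⇔ fwd λ (p , o) →
    from (chain⇔ x∈) p
    , (λ h → beyond-irrefl s (beyond-trans s o (to (chain-∷ x∈) h)))
    , none p o
    where
    fwd : Holds M x (upTo s a as) → P x × Beyond s x m
    fwd (h , h′ , x≢a) with beyond-cmp s x m
    ... | inj₁ x<m         = to (chain⇔ x∈) h , x<m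
    ... | inj₂ (inj₁ refl) = ⊥-elim (x≢a same)
    ... | inj₂ (inj₂ m<x)  = ⊥-elim (h′ (from (chain-∷ x∈) m<x))

-- Covering the words over an alphabet

-- Defines what is left in the middle, when `as` and `bs` are the separators peeled so far from the
-- left and from the right, the latest one first.
between : ∀ {A} → List A → List A → Unary A
between as bs = chain left as ∧ᵘ chain right bs

rank-between : ∀ {A} (as bs : List A) q → rankᵘ q (between as bs) ≤ 1
rank-between as bs q = ⊔-lub (rank-chain left as q) (rank-chain right bs q)

occursBetween : ∀ {A} → List A → A → List A → Closed A
occursBetween as a bs = exist (is a ∧ᵘ between as bs)

rank-occursBetween : ∀ {A} {n} as (a : A) bs → rankˢ (occursBetween as a bs) ≤ suc n
rank-occursBetween as a bs = s≤s (≤-trans (⊔-lub (rank-chain-ex left as) (rank-chain-ex right bs)) z≤n)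

-- A language over B of rank at most n lying in the class of word under Eq d.
record Class {A : Set} (d n : ℕ) (B : List A) : Set where
  field
    sentence : Closed A
    rank≤    : rankˢ sentence ≤ n
    word     : List A
    word⊆B   : All (_∈ B) word
    sound    : ∀ {f g : ℕ → A} {l r l′ r′} → l ≤ r → Over B (f ⟨ l , r ⟩) → True (f ⟨ l , r ⟩) sentence →
               Spells g l′ word r′ → Eq d (f ⟨ l , r ⟩) (g ⟨ l′ , r′ ⟩)

open Class

rank-rel : ∀ {A d n} {B : List A} θ → (∀ q → rankᵘ q θ ≤ 1) → (c : Class d n B) →
           rankˢ (relˢ θ (sentence c)) ≤ suc n
rank-rel θ θ≤1 c = ≤-trans (rankˢ-rel θ≤1 (sentence c)) (s≤s (rank≤ c))

record Classes {A : Set} (d n : ℕ) (B : List A) : Set where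
  field
    list  : List (Class d n B)
    cover : ∀ (f : ℕ → A) l r → l ≤ r → Over B (f ⟨ l , r ⟩) →
            ∃[ c ] c ∈ list × True (f ⟨ l , r ⟩) (sentence c)

open Classes

-- Descriptions by peeled arches

module _ {A : Set} (_≟_ : DecidableEquality A) where

  remove : A → List A → List A
  remove a = filter (λ b → ¬? (b ≟ a))

  ∈-remove⁺ : ∀ {a b} {B : List A} → b ∈ B → b ≢ a → b ∈ remove a B
  ∈-remove⁺ {a} b∈B b≢a = ∈-filter⁺ (λ b → ¬? (b ≟ a)) b∈B b≢a

  ∈-remove⁻ : ∀ {a b} {B : List A} → b ∈ remove a B → b ∈ B × b ≢ a
  ∈-remove⁻ {a} {B = B} = ∈-filter⁻ (λ b → ¬? (b ≟ a)) {xs = B}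

  over-remove : ∀ {a B} {f : ℕ → A} {l r} → Over B (f ⟨ l , r ⟩) → ¬ Occurs a (f ⟨ l , r ⟩) →
                Over (remove a B) (f ⟨ l , r ⟩)
  over-remove over none i∈ = ∈-remove⁺ (over i∈) λ e → none (_ , i∈ , e)

  -- Serves two purposes: it describes a whole word in which `sep` is missing, or the part of an
  -- arch other than its separator.
  record Piece (d n : ℕ) (B : List A) : Set where
    field
      sep   : A
      sep∈B : sep ∈ B
      class : Class d n (remove sep B)

  open Piece

  -- Testing the representative suffices, since game-equivalent segments have the same letters.
  -- Together with its separator, such a piece yields a block containing all of `B`.
  Full : ∀ {d n B} → Piece d n B → Set
  Full {B = B} p = All (_∈ word (class p)) (remove (sep p) B)

  Arch : (d n : ℕ) (B : List A) → Set
  Arch d n B = Σ[ p ∈ Piece d n B ] Full p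

  module _ (d n : ℕ) (B : List A) where

    -- Descriptions of words from which at most t arches have to be peeled on either side,
    -- alternately; the side is that of the next arch.
    data Desc : Side → ℕ → Set where
      core  : Desc left 0
      end   : ∀ {s t} → Piece d n B → Desc s (suc t)
      peelˡ : ∀ {t} → Arch d n B → Desc right (suc t) → Desc left (suc t)
      peelʳ : ∀ {t} → Arch d n B → Desc left t → Desc right (suc t)

  module _ {d n : ℕ} {B : List A} where

    -- The core is represented by the empty word; with enough arches around it, its content does not
    -- matter to the game.
    spelling : ∀ {s t} → Desc d n B s t → List A
    spelling core              = []
    spelling (end p)           = word (class p)
    spelling (peelˡ (p , _) D) = word (class p) ++ sep p ∷ spelling D
    spelling (peelʳ (p , _) D) = spelling D ++ sep p ∷ word (class p)

    -- The meaning intended for `formula`, with the peeled positions made explicit.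
    Fits : ∀ {s t} → (ℕ → A) → ℕ → ℕ → Desc d n B s t → Set
    Fits f l r core              = ⊤
    Fits f l r (end p)           = ¬ Occurs (sep p) (f ⟨ l , r ⟩) × True (f ⟨ l , r ⟩) (sentence (class p))
    Fits f l r (peelˡ (p , _) D) =
      ∃[ m ] First (sep p) (f ⟨ l , r ⟩) m × True (f ⟨ l , m ⟩) (sentence (class p)) × Fits f (suc m) r D
    Fits f l r (peelʳ (p , _) D) =
      ∃[ m ] Last (sep p) (f ⟨ l , r ⟩) m × True (f ⟨ suc m , r ⟩) (sentence (class p)) × Fits f l m D

    -- The peeled positions are located by the chains of separators `as` and `bs` instead of by
    -- nested quantification. The conditions on successive arches are therefore mere conjuncts, and
    -- the rank does not grow with the number of arches.
    formula : ∀ {s t} → List A → List A → Desc d n B s t → Closed A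
    formula as bs core              = ⊤ˢ
    formula as bs (end p)           =
      ¬ˢ occursBetween as (sep p) bs ∧ˢ relˢ (between as bs) (sentence (class p))
    formula as bs (peelˡ (p , _) D) =
      occursBetween as (sep p) bs ∧ˢ relˢ (upTo left (sep p) as) (sentence (class p)) ∧ˢ
      formula (sep p ∷ as) bs D
    formula as bs (peelʳ (p , _) D) =
      occursBetween as (sep p) bs ∧ˢ relˢ (upTo right (sep p) bs) (sentence (class p)) ∧ˢ
      formula as (sep p ∷ bs) D

    rank-formula : ∀ {s t} as bs (D : Desc d n B s t) → rankˢ (formula as bs D) ≤ suc n
    rank-formula as bs core              = z≤n
    rank-formula as bs (end p)           =
      ⊔-lub (rank-occursBetween as (sep p) bs) (rank-rel (between as bs) (rank-between as bs) (class p))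
    rank-formula as bs (peelˡ (p , _) D) = ⊔-lub (rank-occursBetween as (sep p) bs)
      (⊔-lub (rank-rel (upTo left (sep p) as) (rank-upTo left (sep p) as) (class p))
        (rank-formula (sep p ∷ as) bs D))
    rank-formula as bs (peelʳ (p , _) D) = ⊔-lub (rank-occursBetween as (sep p) bs)
      (⊔-lub (rank-rel (upTo right (sep p) bs) (rank-upTo right (sep p) bs) (class p))
        (rank-formula as (sep p ∷ bs) D))

    module _ (f : ℕ → A) (L R : ℕ) where

      private
        M = f ⟨ L , R ⟩

      -- The invariant of peeling: the two chains define exactly the interval not yet peeled.
      record Context (as bs : List A) (l r : ℕ) : Set where
        field
          L≤l    : L ≤ l
          r≤R    : r ≤ R
          l≤r    : l ≤ r
          after  : ∀ {x} → x ∈ˢ M → Holds M x (chain left as) ⇔ (l ≤ x)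
          before : ∀ {x} → x ∈ˢ M → Holds M x (chain right bs) ⇔ (x < r)

        between⇔ : ∀ {x} → x ∈ˢ M → Holds M x (between as bs) ⇔ x ∈ˢ f ⟨ l , r ⟩
        between⇔ x∈ = after x∈ ×-⇔ before x∈

        widen : ∀ {x} → x ∈ˢ f ⟨ l , r ⟩ → x ∈ˢ M
        widen (p , q) = ≤-trans L≤l p , <-≤-trans q r≤R

        occursBetween⇔ : ∀ a → True M (occursBetween as a bs) ⇔ Occurs a (f ⟨ l , r ⟩)
        occursBetween⇔ a = mk⇔ (λ (x , x∈ , e , h) → x , to (between⇔ x∈) h , e)
                               (λ (x , x∈ , e) → x , widen x∈ , e , from (between⇔ (widen x∈)) x∈)

      module _ {as bs : List A} {l r : ℕ} {a : A} {m : ℕ}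
               (C : Context as bs l r) (F : First a (f ⟨ l , r ⟩) m) where

        open Context C

        private
          none : ∀ {j} → l ≤ j → j < m → f j ≢ a
          none p q e = proj₂ (proj₂ F) (_ , (p , q) , e)

        context-first : Context (a ∷ as) bs (suc m) r
        context-first = let m∈ , e , _ = F in record
          { L≤l = ≤-trans L≤l (m≤n⇒m≤1+n (proj₁ m∈)) ; r≤R = r≤R ; l≤r = proj₂ m∈
          ; after = chain-∷ M left a as (l ≤_) after (widen m∈) (proj₁ m∈) e none
          ; before = before }

        rel-first : ∀ φ → True M (relˢ (upTo left a as) φ) ⇔ True (f ⟨ l , m ⟩) φ
        rel-first = let m∈ , e , _ = F in
          true-rel L≤l (≤-trans (<⇒≤ (proj₂ m∈)) r≤R) (upTo left a as)
            (upTo⇔ M left a as (l ≤_) after (widen m∈) (proj₁ m∈) e none)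

      module _ {as bs : List A} {l r : ℕ} {a : A} {m : ℕ}
               (C : Context as bs l r) (F : Last a (f ⟨ l , r ⟩) m) where

        open Context C

        private
          none : ∀ {j} → j < r → m < j → f j ≢ a
          none p q e = proj₂ (proj₂ F) (_ , (q , p) , e)

        context-last : Context as (a ∷ bs) l m
        context-last = let m∈ , e , _ = F in record
          { L≤l = L≤l ; r≤R = ≤-trans (<⇒≤ (proj₂ m∈)) r≤R ; l≤r = proj₁ m∈
          ; after = after
          ; before = chain-∷ M right a bs (_< r) before (widen m∈) (proj₂ m∈) e none }

        rel-last : ∀ φ → True M (relˢ (upTo right a bs) φ) ⇔ True (f ⟨ suc m , r ⟩) φ
        rel-last = let m∈ , e , _ = F in
          true-rel (≤-trans L≤l (m≤n⇒m≤1+n (proj₁ m∈))) r≤R (upTo right a bs)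
            λ x∈ → let ⇔ = upTo⇔ M right a bs (_< r) before (widen m∈) (proj₂ m∈) e none x∈
                   in mk⇔ (swap ∘ to ⇔) (from ⇔ ∘ swap)

      formula⇔ : ∀ {s t as bs l r} (D : Desc d n B s t) → Context as bs l r →
                 True M (formula as bs D) ⇔ Fits f l r D
      formula⇔ core C = ⇔-id _
      formula⇔ {as = as} {bs} (end p) C =
        ¬-cong-⇔ (occursBetween⇔ (sep p)) ×-⇔ true-rel L≤l r≤R (between as bs) between⇔ (sentence (class p))
        where open Context C
      formula⇔ {as = as} {bs} {l} {r} (peelˡ (p , _) D) C = mk⇔
        -- The sentence only asserts that the separator occurs; its first occurrence is then found
        -- by search and is the cut that `upTo` defines.
        (λ (h , h′ , h″) → let m , F = first _≟_ (to (occursBetween⇔ (sep p)) h) in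
           m , F , to (rel-first C F (sentence (class p))) h′ , to (formula⇔ D (context-first C F)) h″)
        (λ (m , F , h′ , h″) →
           from (occursBetween⇔ (sep p)) (m , proj₁ F , proj₁ (proj₂ F))
           , from (rel-first C F (sentence (class p))) h′ , from (formula⇔ D (context-first C F)) h″)
        where open Context C
      formula⇔ {as = as} {bs} {l} {r} (peelʳ (p , _) D) C = mk⇔
        (λ (h , h′ , h″) → let m , F = last _≟_ (to (occursBetween⇔ (sep p)) h) in
           m , F , to (rel-last C F (sentence (class p))) h′ , to (formula⇔ D (context-last C F)) h″)
        (λ (m , F , h′ , h″) →
           from (occursBetween⇔ (sep p)) (m , proj₁ F , proj₁ (proj₂ F))
           , from (rel-last C F (sentence (class p))) h′ , from (formula⇔ D (context-last C F)) h″)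
        where open Context C

      context-[] : L ≤ R → Context [] [] L R
      context-[] L≤R = record
        { L≤l = ≤-refl ; r≤R = ≤-refl ; l≤r = L≤R
        ; after = λ x∈ → mk⇔ (λ _ → proj₁ x∈) (λ _ → tt)
        ; before = λ x∈ → mk⇔ (λ _ → proj₂ x∈) (λ _ → tt) }

-- Soundness of descriptions

eq-occursˡ : ∀ {A d b} {M N : Segment A} → Eq d M N → Occurs b N → Occurs b M
eq-occursˡ {d = d} (_ , t) (j , j∈ , e) =
  let i , x = t j∈ ; i∈ , _ , same = bis-sameLabel d x in i , i∈ , trans same e

eq-occursʳ : ∀ {A d b} {M N : Segment A} → Eq d M N → Occurs b M → Occurs b N
eq-occursʳ {d = d} (t , _) (i , i∈ , e) =
  let j , x = t i∈ ; _ , j∈ , same = bis-sameLabel d x in j , j∈ , trans (sym same) e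

module _ {A : Set} (_≟_ : DecidableEquality A) where

  open import Data.List.Membership.DecPropositional _≟_ using (_∈?_)
  open Piece

  module _ {d n : ℕ} {B : List A} where

    spelling⊆B : ∀ {s t} (D : Desc _≟_ d n B s t) → All (_∈ B) (spelling _≟_ D)
    spelling⊆B core              = []
    spelling⊆B (end p)           = All.map (proj₁ ∘ ∈-remove⁻ _≟_) (word⊆B (class p))
    spelling⊆B (peelˡ (p , _) D) =
      All.++⁺ (All.map (proj₁ ∘ ∈-remove⁻ _≟_) (word⊆B (class p))) (sep∈B p ∷ spelling⊆B D)
    spelling⊆B (peelʳ (p , _) D) =
      All.++⁺ (spelling⊆B D) (sep∈B p ∷ All.map (proj₁ ∘ ∈-remove⁻ _≟_) (word⊆B (class p)))

    module _ {f g : ℕ → A} where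

      -- On the representative's side the separator is present at `x` and fullness gives the other
      -- letters; the equivalence carries all of them over to the other side.
      block : ∀ {l r l′ r′ x} (p : Piece _≟_ d n B) → Full _≟_ p →
              Eq d (f ⟨ l , r ⟩) (g ⟨ l′ , r′ ⟩) →
              g x ≡ sep p → l′ ≤ x × x < r′ →
              (∀ {b} → b ∈ word (class p) → Occurs b (g ⟨ l′ , r′ ⟩)) →
              Block B d (f ⟨ l , r ⟩) (g ⟨ l′ , r′ ⟩)
      block {l = l} {r} {l′} {r′} {x} p full eq e x∈ occ = record
        { equivalent = eq ; fullˡ = eq-occursˡ {d = d} eq ∘ occurs ; fullʳ = occurs }
        where
        occurs : ∀ {b} → b ∈ B → Occurs b (g ⟨ l′ , r′ ⟩)
        occurs {b} b∈B with b ≟ sep p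
        ... | yes refl = x , x∈ , e
        ... | no b≢    = occ (All.lookup full (∈-remove⁺ _≟_ b∈B b≢))

      -- If the description finishes with `end`, every factor is matched and the equivalences
      -- concatenate. If it reaches the core, the arches matched on the way form the nest.
      sound-desc : ∀ {s t l r l′ r′} (D : Desc _≟_ d n B s t) → l ≤ r → Over B (f ⟨ l , r ⟩) →
                   Fits _≟_ f l r D → Spells g l′ (spelling _≟_ D) r′ →
                   Eq d (f ⟨ l , r ⟩) (g ⟨ l′ , r′ ⟩) ⊎ Nest B d f g s t l r l′ r′
      sound-desc core l≤r over fits s = inj₂ (core l≤r (spells-≤ s))
      sound-desc (end p) l≤r over (none , true) s =
        inj₁ (sound (class p) l≤r (over-remove _≟_ over none) true s)
      sound-desc (peelˡ (p , full) D) l≤r over (m , ((l≤m , m<r) , e , none) , true , fits) s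
        with spells-++ (word (class p)) s
      ... | m′ , s₁ , (e′ ∷ s₂) with sound-desc D m<r (over-⊆ (m≤n⇒m≤1+n l≤m) ≤-refl over) fits s₂
      ...   | inj₁ eq = inj₁ (eq-concat (m≤n⇒m≤1+n l≤m) m<r (m≤n⇒m≤1+n (spells-≤ s₁)) (spells-≤ s₂) d eqU eq)
        where
        eqU = eq-concat l≤m (n≤1+n m) (spells-≤ s₁) (n≤1+n m′) d
                (sound (class p) l≤m (over-remove _≟_ (over-⊆ ≤-refl (<⇒≤ m<r) over) none) true s₁)
                (eq-singleton d (trans e (sym e′)))
      ...   | inj₂ N = inj₂ (blockˡ (m≤n⇒m≤1+n l≤m) (m≤n⇒m≤1+n (spells-≤ s₁)) U N)
        where
        eqU = eq-concat l≤m (n≤1+n m) (spells-≤ s₁) (n≤1+n m′) d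
                (sound (class p) l≤m (over-remove _≟_ (over-⊆ ≤-refl (<⇒≤ m<r) over) none) true s₁)
                (eq-singleton d (trans e (sym e′)))
        U = block p full eqU e′ (spells-≤ s₁ , ≤-refl) (occurs-⊆ ≤-refl (n≤1+n m′) ∘ spells-occurs s₁)
      sound-desc (peelʳ (p , full) D) l≤r over (m , ((l≤m , m<r) , e , none) , true , fits) s
        with spells-++ (spelling _≟_ D) s
      ... | m′ , s₂ , (e′ ∷ s₁) = map⊎
        (λ eq → eq-concat l≤m (<⇒≤ m<r) (spells-≤ s₂) (<⇒≤ (spells-≤ s₁)) d eq eqV)
        (blockʳ (<⇒≤ m<r) (<⇒≤ (spells-≤ s₁)) V)
        (sound-desc D l≤m (over-⊆ ≤-refl (<⇒≤ m<r) over) fits s₂)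
        where
        eqV = eq-concat (n≤1+n m) m<r (n≤1+n m′) (spells-≤ s₁) d
                (eq-singleton d (trans e (sym e′)))
                (sound (class p) m<r (over-remove _≟_ (over-⊆ (m≤n⇒m≤1+n l≤m) ≤-refl over) none) true s₁)
        V = block p full eqV e′ (≤-refl , spells-≤ s₁) (occurs-⊆ (n≤1+n m′) ≤-refl ∘ spells-occurs s₁)

  class-of-desc : ∀ {d n B} → Desc _≟_ d n B left (suc d) → Class d (suc n) B
  class-of-desc {d} {n} {B} D = record
    { sentence = formula _≟_ [] [] D
    ; rank≤    = rank-formula _≟_ [] [] D
    ; word     = spelling _≟_ D
    ; word⊆B   = spelling⊆B D
    ; sound    = λ {f} {g} {l} {r} l≤r over true s →
        -- The description has `suc d` arches on each side, as `eq-nest` demands.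
        [ id , (λ N → eq-nest N over (All.lookup (spelling⊆B D) ∘ spells-over s)) ]
        (sound-desc D l≤r over (to (formula⇔ _≟_ f l r D (context-[] _≟_ {d} {n} {B} f l r l≤r)) true) s)
    }

  -- Enumeration of the descriptions

  module _ {d n : ℕ} {b : A} {B′ : List A}
           (ih : ∀ {a} → a ∈ b ∷ B′ → Classes d n (remove _≟_ a (b ∷ B′))) where

    private
      B = b ∷ B′

    -- The separators run over indices into `B`, because each index brings the membership proof that
    -- `ih` asks for.
    pieces : List (Piece _≟_ d n B)
    pieces = concatMap
      (λ i → map (λ c → record { sep∈B = ∈-lookup {xs = B} i ; class = c }) (list (ih (∈-lookup i))))
      (allFin (length B))

    piece : ∀ {a} → a ∈ B → ∀ f l r → l ≤ r → Over (remove _≟_ a B) (f ⟨ l , r ⟩) →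
            ∃[ p ] p ∈ pieces × sep p ≡ a × True (f ⟨ l , r ⟩) (sentence (class p))
    piece a∈B f l r l≤r = at (Any.index a∈B) (Any.lookup-index a∈B)
      where
      at : ∀ {a} i → a ≡ lookup B i → Over (remove _≟_ a B) (f ⟨ l , r ⟩) →
           ∃[ p ] p ∈ pieces × sep p ≡ a × True (f ⟨ l , r ⟩) (sentence (class p))
      at i refl over =
        let c , c∈ , true = cover (ih (∈-lookup i)) f l r l≤r over
        in _ , ∈-concatMap⁺ _ (lose (∈-allFin i) (∈-map⁺ _ c∈)) , refl , true

    ifFull : ∀ p → Dec (Full _≟_ p) → List (Arch _≟_ d n B)
    ifFull p (yes full) = (p , full) ∷ []
    ifFull p (no _)     = []

    full? : (p : Piece _≟_ d n B) → Dec (Full _≟_ p)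
    full? p = All.all? (_∈? word (class p)) _

    archs : List (Arch _≟_ d n B)
    archs = concatMap (λ p → ifFull p (full? p)) pieces

    -- The segment contains all letters other than `a`, and the representative of its class is
    -- game-equivalent to it, so the representative contains them too and the piece passes the test
    -- for fullness.
    arch : ∀ {a} → a ∈ B → ∀ f l r → l ≤ r → Over (remove _≟_ a B) (f ⟨ l , r ⟩) →
           (∀ {c} → c ∈ remove _≟_ a B → Occurs c (f ⟨ l , r ⟩)) →
           ∃[ p ] p ∈ archs × sep (proj₁ p) ≡ a × True (f ⟨ l , r ⟩) (sentence (class (proj₁ p)))
    arch a∈B f l r l≤r over occ with piece a∈B f l r l≤r over
    ... | p , p∈ , refl , true =
      let full′ , ∈ifFull = find-full (full? p)
      in (p , full′) , ∈-concatMap⁺ _ (lose p∈ ∈ifFull) , refl , true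
      where
      u = word (class p)
      full : Full _≟_ p
      full = All.tabulate λ c∈ →
        let s = spells-letterAt (sep p) u
            j , j∈ , e = eq-occursʳ {d = d} (sound (class p) l≤r over true s) (occ c∈)
        in subst (_∈ u) e (spells-over s j∈)
      find-full : (dec : Dec (Full _≟_ p)) → ∃[ full′ ] (p , full′) ∈ ifFull p dec
      find-full (yes full′) = full′ , here refl
      find-full (no ¬full)  = ⊥-elim (¬full full)

    mutual
      descsˡ : ∀ t → List (Desc _≟_ d n B left t)
      descsˡ zero    = core ∷ []
      descsˡ (suc t) = map end pieces ++ cartesianProductWith peelˡ archs (descsʳ t)

      descsʳ : ∀ t → List (Desc _≟_ d n B right (suc t))
      descsʳ t = map end pieces ++ cartesianProductWith peelʳ archs (descsˡ t)

    mutual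
      completeˡ : ∀ t f l r → l ≤ r → Over B (f ⟨ l , r ⟩) → ∃[ D ] D ∈ descsˡ t × Fits _≟_ f l r D
      completeˡ zero f l r l≤r over = core , here refl , tt
      completeˡ (suc t) f l r l≤r over with missing? _≟_ B f l r
      ... | inj₁ (a , a∈B , none) with piece a∈B f l r l≤r (over-remove _≟_ over none)
      ...   | p , p∈ , refl , true = end p , ∈-++⁺ˡ (∈-map⁺ end p∈) , none , true
      completeˡ (suc t) f l r l≤r over | inj₂ full with last-first _≟_ full
      ... | a , m , a∈B , F@((l≤m , m<r) , e , none) , occ
        with arch a∈B f l m l≤m (over-remove _≟_ (over-⊆ ≤-refl (<⇒≤ m<r) over) none) occ′
           | completeʳ t f (suc m) r m<r (over-⊆ (m≤n⇒m≤1+n l≤m) ≤-refl over)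
        where
        -- The prefix up to and including `m` contains all of `B`, and position `m` carries `a`;
        -- every other letter must then occur before `m`.
        occ′ : ∀ {c} → c ∈ remove _≟_ a B → Occurs c (f ⟨ l , m ⟩)
        occ′ c∈ with c∈B , c≢a ← ∈-remove⁻ _≟_ c∈ | occ c∈B
        ... | i , (p , s≤s q) , e′ with m≤n⇒m<n∨m≡n q
        ...   | inj₁ i<m  = i , (p , i<m) , e′
        ...   | inj₂ refl = ⊥-elim (c≢a (trans (sym e′) e))
      ...   | p , p∈ , refl , true | D , D∈ , fits =
        peelˡ p D , ∈-++⁺ʳ (map end pieces) (∈-cartesianProductWith⁺ peelˡ p∈ D∈) , m , F , true , fits

      completeʳ : ∀ t f l r → l ≤ r → Over B (f ⟨ l , r ⟩) → ∃[ D ] D ∈ descsʳ t × Fits _≟_ f l r D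
      completeʳ t f l r l≤r over with missing? _≟_ B f l r
      ... | inj₁ (a , a∈B , none) with piece a∈B f l r l≤r (over-remove _≟_ over none)
      ...   | p , p∈ , refl , true = end p , ∈-++⁺ˡ (∈-map⁺ end p∈) , none , true
      completeʳ t f l r l≤r over | inj₂ full with first-last _≟_ full
      ... | a , m , a∈B , F@((l≤m , m<r) , e , none) , occ
        with arch a∈B f (suc m) r m<r (over-remove _≟_ (over-⊆ (m≤n⇒m≤1+n l≤m) ≤-refl over) none) occ′
           | completeˡ t f l m l≤m (over-⊆ ≤-refl (<⇒≤ m<r) over)
        where
        occ′ : ∀ {c} → c ∈ remove _≟_ a B → Occurs c (f ⟨ suc m , r ⟩)
        occ′ c∈ with c∈B , c≢a ← ∈-remove⁻ _≟_ c∈ | occ c∈B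
        ... | i , (p , q) , e′ with m≤n⇒m<n∨m≡n p
        ...   | inj₁ m<i  = i , (m<i , q) , e′
        ...   | inj₂ refl = ⊥-elim (c≢a (trans (sym e′) e))
      ...   | p , p∈ , refl , true | D , D∈ , fits =
        peelʳ p D , ∈-++⁺ʳ (map end pieces) (∈-cartesianProductWith⁺ peelʳ p∈ D∈) , m , F , true , fits

    classes-step : Classes d (suc n) B
    classes-step = record
      { list  = map class-of-desc (descsˡ (suc d))
      ; cover = λ f l r l≤r over →
          let D , D∈ , fits = completeˡ (suc d) f l r l≤r over
          in class-of-desc D , ∈-map⁺ class-of-desc D∈
           , from (formula⇔ _≟_ f l r D (context-[] _≟_ {d} {n} {B} f l r l≤r)) fits
      }

  -- Passing from `remove _≟_ a B` to `B` costs one block. The list gets strictly shorter by the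
  -- removal, so a bound on its length also bounds the rank; over the empty alphabet only empty
  -- segments remain and rank 0 is enough.
  classes : ∀ d n B → length B ≤ n → Classes d n B
  classes d n [] _ = record
    { list  = record { sentence = ⊤ˢ ; rank≤ = z≤n ; word = [] ; word⊆B = [] ; sound = snd } ∷ []
    ; cover = λ _ _ _ _ _ → _ , here refl , tt }
    where
    snd : ∀ {f g : ℕ → A} {l r l′ r′} → l ≤ r → Over [] (f ⟨ l , r ⟩) → ⊤ → Spells g l′ [] r′ →
          Eq d (f ⟨ l , r ⟩) (g ⟨ l′ , r′ ⟩)
    snd _ over _ [] = (λ i∈ → case over i∈ of λ ()) , (λ (p , q) → ⊥-elim (<⇒≱ q p))
  classes d (suc n) B@(_ ∷ _) le = classes-step λ {a} a∈B → classes d n (remove _≟_ a B)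
    (≤-pred (≤-trans (filter-notAll (λ b → ¬? (b ≟ a)) B (Any.map (λ { refl ¬p → ¬p refl }) a∈B)) le))

-- The translation of unary temporal logic

other : Var → Var
other 0F        = sucF 0F
other (sucF 0F) = 0F

bound : ∀ {m} (Γ : Subset m) v → v ∈ᵥ Γ [ v ]≔ inside
bound (_ ∷ Γ) 0F       = here
bound (_ ∷ Γ) (sucF v) = there (bound Γ v)

kept : ∀ {Γ : Subset 2} v → v ∈ᵥ Γ → v ∈ᵥ Γ [ other v ]≔ inside
kept {_ ∷ _ ∷ []} 0F        here         = here
kept {_ ∷ _ ∷ []} (sucF 0F) (there here) = there here

update-bound : ∀ {m n} {Γ : Subset m} (ρ : Env Γ n) v i → update ρ v i (bound Γ v) ≡ i
update-bound {Γ = _ ∷ _} ρ 0F       i = refl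
update-bound {Γ = _ ∷ _} ρ (sucF v) i = update-bound (λ q → ρ (there q)) v i

update-kept : ∀ {n} {Γ : Subset 2} (ρ : Env Γ n) v i (p : v ∈ᵥ Γ) → update ρ (other v) i (kept v p) ≡ ρ p
update-kept {Γ = _ ∷ _ ∷ []} ρ 0F        i here         = refl
update-kept {Γ = _ ∷ _ ∷ []} ρ (sucF 0F) i (there here) = refl

side : ∀ {A Γ u v} → Side → u ∈ᵥ Γ → v ∈ᵥ Γ → Formula A Γ
side left  p q = p ≺ q
side right p q = q ≺ p

⟦_⟧ᵘ : ∀ {A Γ} → Unary A → (v : Var) → v ∈ᵥ Γ → Formula A Γ
⟦ ⊤ᵘ ⟧ᵘ v p       = p ≐ p
⟦ is a ⟧ᵘ v p     = letter a p
⟦ ¬ᵘ α ⟧ᵘ v p     = ¬′ ⟦ α ⟧ᵘ v p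
⟦ α ∧ᵘ β ⟧ᵘ v p   = ⟦ α ⟧ᵘ v p ∧′ ⟦ β ⟧ᵘ v p
⟦ some s α ⟧ᵘ v p =
  ∃′ (other v) (side s (bound _ (other v)) (kept v p) ∧′ ⟦ α ⟧ᵘ (other v) (bound _ (other v)))

⟦_⟧ : ∀ {A} → Closed A → Sentence A
-- With no variable in scope every atom needs a quantifier, so truth is an instance of excluded
-- middle, valid in the empty word as well.
⟦ ⊤ˢ ⟧      = ∃′ 0F (here ≐ here) ∨′ ¬′ ∃′ 0F (here ≐ here)
⟦ ¬ˢ φ ⟧    = ¬′ ⟦ φ ⟧
⟦ φ ∧ˢ ψ ⟧  = ⟦ φ ⟧ ∧′ ⟦ ψ ⟧
⟦ exist α ⟧ = ∃′ 0F (⟦ α ⟧ᵘ 0F here)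

wordSegment : ∀ {A} → A → List A → Segment A
wordSegment d w = letterAt d w ⟨ 0 , length w ⟩

lookup-letterAt : ∀ {A} (d : A) w i → lookup w i ≡ letterAt d w (toℕ i)
lookup-letterAt d (a ∷ w) 0F       = refl
lookup-letterAt d (a ∷ w) (sucF i) = lookup-letterAt d w i

toℕ-∈ : ∀ {A} {f : ℕ → A} {n} (i : Fin n) → toℕ i ∈ˢ f ⟨ 0 , n ⟩
toℕ-∈ i = z≤n , Fin.toℕ<n i

fromˢ : ∀ {n} (P : ℕ → Set) {i} → 0 ≤ i × i < n → P i → Σ[ j ∈ Fin n ] P (toℕ j)
fromˢ P (_ , i<n) x = fromℕ< i<n , subst P (sym (Fin.toℕ-fromℕ< i<n)) x

module _ {A : Set} (_≟_ : DecidableEquality A) where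

  sat? : ∀ {Γ} (w : List A) (ρ : Env Γ (length w)) φ → Dec (Sat w ρ φ)
  sat? w ρ (p ≺ q)      = ρ p Fin.<? ρ q
  sat? w ρ (p ≐ q)      = ρ p Fin.≟ ρ q
  sat? w ρ (letter a p) = lookup w (ρ p) ≟ a
  sat? w ρ (¬′ φ)       = ¬? (sat? w ρ φ)
  sat? w ρ (φ ∧′ ψ)     = sat? w ρ φ ×-dec sat? w ρ ψ
  sat? w ρ (φ ∨′ ψ)     = sat? w ρ φ ⊎-dec sat? w ρ ψ
  sat? w ρ (∃′ v φ)     = Fin.any? λ i → sat? w (update ρ v i) φ
  sat? w ρ (∀′ v φ)     = Fin.all? λ i → sat? w (update ρ v i) φ

  models? : ∀ w (φ : Sentence A) → Dec (w ⊨ φ)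
  models? w φ = sat? w emptyEnv φ

module _ {A : Set} (_≟_ : DecidableEquality A) (d : A) where

  ⟦⟧ᵘ⇔ : ∀ {Γ} w (ρ : Env Γ (length w)) α v p {i} → toℕ (ρ p) ≡ i →
         Sat w ρ (⟦ α ⟧ᵘ v p) ⇔ Holds (wordSegment d w) i α
  ⟦⟧ᵘ⇔ w ρ ⊤ᵘ v p refl = mk⇔ (λ _ → tt) (λ _ → refl)
  ⟦⟧ᵘ⇔ w ρ (is a) v p refl rewrite lookup-letterAt d w (ρ p) = ⇔-id _
  ⟦⟧ᵘ⇔ w ρ (¬ᵘ α) v p e = ¬-cong-⇔ (⟦⟧ᵘ⇔ w ρ α v p e)
  ⟦⟧ᵘ⇔ w ρ (α ∧ᵘ β) v p e = ⟦⟧ᵘ⇔ w ρ α v p e ×-⇔ ⟦⟧ᵘ⇔ w ρ β v p e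
  ⟦⟧ᵘ⇔ {Γ} w ρ (some s α) v p refl = mk⇔
    (λ (i , o , h) → toℕ i , toℕ-∈ {f = letterAt d w} i , to (side⇔ s i) o , to (rec i) h)
    (λ (_ , i∈ , o , h) →
      let i , o′ , h′ = fromˢ (λ x → Beyond s x (toℕ (ρ p)) × Holds (wordSegment d w) x α) i∈ (o , h)
      in i , from (side⇔ s i) o′ , from (rec i) h′)
    where
    u = other v
    rec : ∀ i → Sat w (update ρ u i) (⟦ α ⟧ᵘ u (bound _ u)) ⇔ Holds (wordSegment d w) (toℕ i) α
    rec i = ⟦⟧ᵘ⇔ w (update ρ u i) α u (bound _ u) (cong toℕ (update-bound ρ u i))
    side⇔ : ∀ s i → Sat w (update ρ u i) (side s (bound _ u) (kept v p)) ⇔ Beyond s (toℕ i) (toℕ (ρ p))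
    side⇔ left  i rewrite update-bound ρ u i | update-kept ρ v i p = ⇔-id _
    side⇔ right i rewrite update-bound ρ u i | update-kept ρ v i p = ⇔-id _

  ⟦⟧⇔ : ∀ w φ → (w ⊨ ⟦ φ ⟧) ⇔ True (wordSegment d w) φ
  ⟦⟧⇔ w ⊤ˢ        = mk⇔ (λ _ → tt) (λ _ → toSum (models? _≟_ w (∃′ 0F (here ≐ here))))
  ⟦⟧⇔ w (¬ˢ φ)    = ¬-cong-⇔ (⟦⟧⇔ w φ)
  ⟦⟧⇔ w (φ ∧ˢ ψ)  = ⟦⟧⇔ w φ ×-⇔ ⟦⟧⇔ w ψ
  ⟦⟧⇔ w (exist α) = mk⇔
    (λ (i , h) → toℕ i , toℕ-∈ {f = letterAt d w} i , to (rec i) h)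
    (λ (_ , i∈ , h) → let i , h′ = fromˢ (λ x → Holds (wordSegment d w) x α) i∈ h in i , from (rec i) h′)
    where
    rec : ∀ i → Sat w (update emptyEnv 0F i) (⟦ α ⟧ᵘ 0F here) ⇔ Holds (wordSegment d w) (toℕ i) α
    rec i = ⟦⟧ᵘ⇔ w (update emptyEnv 0F i) α 0F here refl

-- Quantifier blocks

-- Prefixing `q` lets an initial run of `q` merge with it, in agreement with `rankᵘ`; the extra one
-- in the bound is the block of `q` itself.
Below : ∀ {A Γ} → Quantifier → ℕ → Formula A Γ → Set
Below q n φ = All (λ qs → blocks (q ∷ qs) ≤ suc n) (paths φ)

mutual
  below-nnf : ∀ {A Γ} q n (α : Unary A) v (p : v ∈ᵥ Γ) → rankᵘ q α ≤ n → Below q n (nnf (⟦ α ⟧ᵘ v p))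
  below-nnf q n ⊤ᵘ         v p le = s≤s z≤n ∷ []
  below-nnf q n (is a)     v p le = s≤s z≤n ∷ []
  below-nnf q n (¬ᵘ α)     v p le = below-nnf¬ q n α v p le
  below-nnf q n (α ∧ᵘ β)   v p le =
    All.++⁺ (below-nnf q n α v p (≤-trans (m≤m⊔n _ _) le)) (below-nnf q n β v p (≤-trans (m≤n⊔m _ _) le))
  -- The two sides are treated separately so that `side` computes to an atom, whose path is the
  -- first entry of the list.
  below-nnf ex n (some left α) v p le = All.map⁺ (s≤s z≤n ∷ below-nnf ex n α _ _ le)
  below-nnf ex n (some right α) v p le = All.map⁺ (s≤s z≤n ∷ below-nnf ex n α _ _ le)
  below-nnf all (suc n) (some left α) v p (s≤s le) =
    All.map⁺ (s≤s (s≤s z≤n) ∷ All.map s≤s (below-nnf ex n α _ _ le))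
  below-nnf all (suc n) (some right α) v p (s≤s le) =
    All.map⁺ (s≤s (s≤s z≤n) ∷ All.map s≤s (below-nnf ex n α _ _ le))

  below-nnf¬ : ∀ {A Γ} q n (α : Unary A) v (p : v ∈ᵥ Γ) → rankᵘ (dual q) α ≤ n → Below q n (nnf¬ (⟦ α ⟧ᵘ v p))
  below-nnf¬ q n ⊤ᵘ         v p le = s≤s z≤n ∷ []
  below-nnf¬ q n (is a)     v p le = s≤s z≤n ∷ []
  below-nnf¬ ex  n (¬ᵘ α)   v p le = below-nnf ex n α v p le
  below-nnf¬ all n (¬ᵘ α)   v p le = below-nnf all n α v p le
  below-nnf¬ q n (α ∧ᵘ β)   v p le =
    All.++⁺ (below-nnf¬ q n α v p (≤-trans (m≤m⊔n _ _) le)) (below-nnf¬ q n β v p (≤-trans (m≤n⊔m _ _) le))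
  below-nnf¬ all n (some left α) v p le = All.map⁺ (s≤s z≤n ∷ below-nnf¬ all n α _ _ le)
  below-nnf¬ all n (some right α) v p le = All.map⁺ (s≤s z≤n ∷ below-nnf¬ all n α _ _ le)
  below-nnf¬ ex (suc n) (some left α) v p (s≤s le) =
    All.map⁺ (s≤s (s≤s z≤n) ∷ All.map s≤s (below-nnf¬ all n α _ _ le))
  below-nnf¬ ex (suc n) (some right α) v p (s≤s le) =
    All.map⁺ (s≤s (s≤s z≤n) ∷ All.map s≤s (below-nnf¬ all n α _ _ le))

AtMost : ∀ {A Γ} → ℕ → Formula A Γ → Set
AtMost n φ = All (λ qs → blocks qs ≤ n) (paths φ)

mutual
  atMost-nnf : ∀ {A} n (φ : Closed A) → rankˢ φ ≤ suc n → AtMost (suc n) (nnf ⟦ φ ⟧)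
  atMost-nnf n ⊤ˢ        le       = s≤s z≤n ∷ s≤s z≤n ∷ []
  atMost-nnf n (¬ˢ φ)    le       = atMost-nnf¬ n φ le
  atMost-nnf n (φ ∧ˢ ψ)  le       =
    All.++⁺ (atMost-nnf n φ (≤-trans (m≤m⊔n _ _) le)) (atMost-nnf n ψ (≤-trans (m≤n⊔m _ _) le))
  atMost-nnf n (exist α) (s≤s le) = All.map⁺ (below-nnf ex n α _ _ le)

  atMost-nnf¬ : ∀ {A} n (φ : Closed A) → rankˢ φ ≤ suc n → AtMost (suc n) (nnf¬ ⟦ φ ⟧)
  atMost-nnf¬ n ⊤ˢ        le       = s≤s z≤n ∷ s≤s z≤n ∷ []
  atMost-nnf¬ n (¬ˢ φ)    le       = atMost-nnf n φ le
  atMost-nnf¬ n (φ ∧ˢ ψ)  le       =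
    All.++⁺ (atMost-nnf¬ n φ (≤-trans (m≤m⊔n _ _) le)) (atMost-nnf¬ n ψ (≤-trans (m≤n⊔m _ _) le))
  atMost-nnf¬ n (exist α) (s≤s le) = All.map⁺ (below-nnf¬ all n α _ _ le)

-- Padding to an exact number of blocks

maxBlocks : List (List Quantifier) → ℕ
maxBlocks pss = foldr _⊔_ 0 (map blocks pss)

maxBlocks-++ : ∀ pss qss → maxBlocks (pss ++ qss) ≡ maxBlocks pss ⊔ maxBlocks qss
maxBlocks-++ []         qss = refl
maxBlocks-++ (ps ∷ pss) qss =
  trans (cong (blocks ps ⊔_) (maxBlocks-++ pss qss)) (sym (⊔-assoc (blocks ps) _ _))

maxBlocks-≤ : ∀ {n pss} → All (λ qs → blocks qs ≤ n) pss → maxBlocks pss ≤ n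
maxBlocks-≤ []         = z≤n
maxBlocks-≤ (le ∷ les) = ⊔-lub le (maxBlocks-≤ les)

tower : ∀ {A} → ℕ → Quantifier → Formula A (inside ∷ outside ∷ [])
tower zero    q   = here ≐ here
tower (suc n) ex  = ∃′ 0F (tower n all)
tower (suc n) all = ∀′ 0F (tower n ex)

alternating : ℕ → Quantifier → List Quantifier
alternating zero    q = []
alternating (suc n) q = q ∷ alternating n (dual q)

paths-tower : ∀ {A} n q → paths (nnf (tower {A} n q)) ≡ alternating n q ∷ []
paths-tower zero    q   = refl
paths-tower {A} (suc n) ex  rewrite paths-tower {A} n all = refl
paths-tower {A} (suc n) all rewrite paths-tower {A} n ex  = refl

paths-tower¬ : ∀ {A} n q → paths (nnf¬ (tower {A} n q)) ≡ alternating n (dual q) ∷ []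
paths-tower¬ zero    q   = refl
paths-tower¬ {A} (suc n) ex  rewrite paths-tower¬ {A} n all = refl
paths-tower¬ {A} (suc n) all rewrite paths-tower¬ {A} n ex  = refl

blocks-alternating : ∀ n q → blocks (alternating n q) ≡ n
blocks-alternating zero          q   = refl
blocks-alternating (suc zero)    q   = refl
blocks-alternating (suc (suc n)) ex  = cong suc (blocks-alternating (suc n) all)
blocks-alternating (suc (suc n)) all = cong suc (blocks-alternating (suc n) ex)

-- A sentence of the form ψ ∨′ ¬′ ψ, so that padding with it is harmless even in the empty word.
padding : ∀ {A} → ℕ → Sentence A
padding n = ∃′ 0F (tower n all) ∨′ ¬′ ∃′ 0F (tower n all)

⊨-padding : ∀ {A} → DecidableEquality A → ∀ n (w : List A) → w ⊨ padding n
⊨-padding _≟_ n w = toSum (models? _≟_ w (∃′ 0F (tower n all)))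

maxBlocks-padding : ∀ {A} n → maxBlocks (paths (nnf (padding {A} n))) ≡ suc n
maxBlocks-padding {A} n rewrite paths-tower {A} n all | paths-tower¬ {A} n all
  | blocks-alternating (suc n) ex | blocks-alternating (suc n) all = ⊔-idem (suc n)

numBlocks-pad : ∀ {A} n (φ : Sentence A) → AtMost (suc n) (nnf φ) → numBlocks (φ ∧′ padding n) ≡ suc n
numBlocks-pad {A} n φ le = trans (maxBlocks-++ (paths (nnf φ)) (paths (nnf (padding {A} n))))
  (trans (cong (maxBlocks (paths (nnf φ)) ⊔_) (maxBlocks-padding {A} n)) (m≤n⇒m⊔n≡n (maxBlocks-≤ le)))

-- Two-variable formulas and the game

bis-sym : ∀ {A} d {M N : Segment A} {i j} → Bis d M N i j → Bis d N M j i
bis-sym zero            (p , q , e) = q , p , sym e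
bis-sym (suc d) {M} {N} b = step-bis d {R = flip (Bis (suc d) M N)} {R′ = flip (Bis d M N)}
  (λ b → same-sym {M = M} {N} (bis-sameLabel (suc d) {M} {N} b))
  (record { forth = back (bis-step d) ; back = forth (bis-step d) })
  (bis-sym d) b

eq-sym : ∀ {A} d {M N : Segment A} → Eq d M N → Eq d N M
eq-sym d (t , t′) = (λ p → map₂ (bis-sym d) (t′ p)) , (λ p → map₂ (bis-sym d) (t p))

depth : ∀ {A Γ} → Formula A Γ → ℕ
depth (_ ≺ _)      = 0
depth (_ ≐ _)      = 0
depth (letter _ _) = 0
depth (¬′ φ)       = depth φ
depth (φ ∧′ ψ)     = depth φ ⊔ depth ψ
depth (φ ∨′ ψ)     = depth φ ⊔ depth ψ
depth (∃′ _ φ)     = suc (depth φ)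
depth (∀′ _ φ)     = suc (depth φ)

data SameOrder (i j i′ j′ : ℕ) : Set where
  lt : i < j → i′ < j′ → SameOrder i j i′ j′
  eq : i ≡ j → i′ ≡ j′ → SameOrder i j i′ j′
  gt : j < i → j′ < i′ → SameOrder i j i′ j′

order-flip : ∀ {i j i′ j′} → SameOrder i j i′ j′ → SameOrder j i j′ i′
order-flip (lt p q) = gt p q
order-flip (eq p q) = eq (sym p) (sym q)
order-flip (gt p q) = lt p q

order-swap : ∀ {i j i′ j′} → SameOrder i j i′ j′ → SameOrder i′ j′ i j
order-swap (lt p q) = lt q p
order-swap (eq p q) = eq q p
order-swap (gt p q) = gt q p

-- The alternatives are uniform in the word and the assignment, so one case distinction handles both
-- words of the game at once.
update-view : ∀ {Γ : Subset 2} {u} v (q : u ∈ᵥ Γ [ v ]≔ inside) →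
  (∀ {n} (ρ : Env Γ n) i → update ρ v i q ≡ i) ⊎
  (Σ[ p ∈ other v ∈ᵥ Γ ] ∀ {n} (ρ : Env Γ n) i → update ρ v i q ≡ ρ p)
update-view {_ ∷ _ ∷ []} 0F        here         = inj₁ λ ρ i → refl
update-view {_ ∷ _ ∷ []} 0F        (there here) = inj₂ (there here , λ ρ i → refl)
update-view {_ ∷ _ ∷ []} (sucF 0F) here         = inj₂ (here , λ ρ i → refl)
update-view {_ ∷ _ ∷ []} (sucF 0F) (there here) = inj₁ λ ρ i → refl

module _ {A : Set} (d : A) where

  -- Either pebble may be lifted next, so each pair must be winning when left alone on the board;
  -- jointly the pairs only have to agree in order.
  record Similar {Γ : Subset 2} (e : ℕ) (w w′ : List A)
                 (ρ : Env Γ (length w)) (ρ′ : Env Γ (length w′)) : Set where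
    field
      bis : ∀ {v} (p : v ∈ᵥ Γ) → Bis e (wordSegment d w) (wordSegment d w′) (toℕ (ρ p)) (toℕ (ρ′ p))
      ord : ∀ {u v} (p : u ∈ᵥ Γ) (q : v ∈ᵥ Γ) → SameOrder (toℕ (ρ p)) (toℕ (ρ q)) (toℕ (ρ′ p)) (toℕ (ρ′ q))

  open Similar

  similar-sym : ∀ {Γ e w w′} {ρ : Env Γ (length w)} {ρ′ : Env Γ (length w′)} →
                Similar e w w′ ρ ρ′ → Similar e w′ w ρ′ ρ
  similar-sym {e = e} S = record { bis = λ p → bis-sym e (bis S p) ; ord = λ p q → order-swap (ord S p q) }

  module _ {Γ : Subset 2} {e : ℕ} (w w′ : List A) {ρ : Env Γ (length w)} {ρ′ : Env Γ (length w′)}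
           (total : Eq (suc e) (wordSegment d w) (wordSegment d w′)) (S : Similar (suc e) w w′ ρ ρ′) where

    private
      M = wordSegment d w
      N = wordSegment d w′

    extend : ∀ v {i j} → Bis e M N (toℕ i) (toℕ j) →
             (∀ (p : other v ∈ᵥ Γ) → SameOrder (toℕ i) (toℕ (ρ p)) (toℕ j) (toℕ (ρ′ p))) →
             Similar e w w′ (update ρ v i) (update ρ′ v j)
    extend v {i} {j} b o = record { bis = bis′ ; ord = ord′ }
      where
      bis′ : ∀ {u} (q : u ∈ᵥ Γ [ v ]≔ inside) → Bis e M N (toℕ (update ρ v i q)) (toℕ (update ρ′ v j q))
      bis′ q with update-view v q
      ... | inj₁ ≡i       rewrite ≡i ρ i | ≡i ρ′ j = b
      ... | inj₂ (p , ≡p) rewrite ≡p ρ i | ≡p ρ′ j = bis-pred e (bis S p)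
      ord′ : ∀ {u u′} (q : u ∈ᵥ Γ [ v ]≔ inside) (q′ : u′ ∈ᵥ Γ [ v ]≔ inside) →
             SameOrder (toℕ (update ρ v i q)) (toℕ (update ρ v i q′))
                       (toℕ (update ρ′ v j q)) (toℕ (update ρ′ v j q′))
      ord′ q q′ with update-view v q | update-view v q′
      ... | inj₁ ≡i       | inj₁ ≡i′        rewrite ≡i ρ i | ≡i ρ′ j | ≡i′ ρ i | ≡i′ ρ′ j = eq refl refl
      ... | inj₁ ≡i       | inj₂ (p′ , ≡p′) rewrite ≡i ρ i | ≡i ρ′ j | ≡p′ ρ i | ≡p′ ρ′ j = o p′
      ... | inj₂ (p , ≡p) | inj₁ ≡i′        rewrite ≡p ρ i | ≡p ρ′ j | ≡i′ ρ i | ≡i′ ρ′ j = order-flip (o p)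
      ... | inj₂ (p , ≡p) | inj₂ (p′ , ≡p′) rewrite ≡p ρ i | ≡p ρ′ j | ≡p′ ρ i | ≡p′ ρ′ j = ord S p p′

    -- The pebble for `v` is lifted, and the reply is governed by the pebble for the other variable:
    -- an opening move if there is none, otherwise a move of its game in the direction of `i`.
    respond : ∀ v i → ∃[ j ] Similar e w w′ (update ρ v i) (update ρ′ v j)
    respond v i with other v ∈ᵥ? Γ
    ... | no ∉Γ =
      let _ , b = proj₁ total (toℕ-∈ {f = letterAt d w} i)
          j , b′ = fromˢ (Bis e M N (toℕ i)) (proj₂ (bis-within e (bis-pred e b))) (bis-pred e b)
      in j , extend v b′ λ p → ⊥-elim (∉Γ p)
    ... | yes p with <-cmp (toℕ i) (toℕ (ρ p))
    -- A move onto the other pebble is not covered by `Forth`; the reply is the partner of that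
    -- pebble.
    ...   | tri≈ _ i≡ _ = ρ′ p , extend v (subst (λ x → Bis e M N x _) (sym i≡) (bis-pred e (bis S p)))
      λ p′ → subst (λ z → SameOrder (toℕ i) (toℕ (ρ z)) (toℕ (ρ′ p)) (toℕ (ρ′ z)))
                   ([]=-irrelevant p p′) (eq i≡ refl)
    ...   | tri< i< _ _ =
      let _ , o , b = forth (bis-step e) (bis S p) left (toℕ-∈ {f = letterAt d w} i) i<
          j , o′ , b′ = fromˢ (λ x → x < toℕ (ρ′ p) × Bis e M N (toℕ i) x) (proj₂ (bis-within e b)) (o , b)
      in j , extend v b′ λ p′ →
        subst (λ z → SameOrder (toℕ i) (toℕ (ρ z)) (toℕ j) (toℕ (ρ′ z))) ([]=-irrelevant p p′) (lt i< o′)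
    ...   | tri> _ _ >i =
      let _ , o , b = forth (bis-step e) (bis S p) right (toℕ-∈ {f = letterAt d w} i) >i
          j , o′ , b′ = fromˢ (λ x → toℕ (ρ′ p) < x × Bis e M N (toℕ i) x) (proj₂ (bis-within e b)) (o , b)
      in j , extend v b′ λ p′ →
        subst (λ z → SameOrder (toℕ i) (toℕ (ρ z)) (toℕ j) (toℕ (ρ′ z))) ([]=-irrelevant p p′) (gt >i o′)

  -- One implication suffices, since negation and universal quantification exchange the two words
  -- and the game is symmetric. `Eq` is carried along for quantifiers that leave no other pebble on
  -- the board.
  invariant : ∀ {Γ} e w w′ {ρ : Env Γ (length w)} {ρ′ : Env Γ (length w′)} φ → depth φ ≤ e →
              Eq e (wordSegment d w) (wordSegment d w′) → Similar e w w′ ρ ρ′ →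
              Sat w ρ φ → Sat w′ ρ′ φ
  invariant e w w′ (p ≺ q) le total S ρp<ρq with ord S p q
  ... | lt _ i<j  = i<j
  ... | eq ρp≡ρq _ = ⊥-elim (<-irrefl ρp≡ρq ρp<ρq)
  ... | gt ρq<ρp _ = ⊥-elim (<-asym ρp<ρq ρq<ρp)
  invariant e w w′ (p ≐ q) le total S ρp≡ρq with ord S p q
  ... | lt ρp<ρq _ = ⊥-elim (<-irrefl (cong toℕ ρp≡ρq) ρp<ρq)
  ... | eq _ i≡j   = Fin.toℕ-injective i≡j
  ... | gt ρq<ρp _ = ⊥-elim (<-irrefl (cong toℕ (sym ρp≡ρq)) ρq<ρp)
  invariant e w w′ {ρ} {ρ′} (letter a p) le total S ρp≡a =
    trans (lookup-letterAt d w′ (ρ′ p))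
      (trans (sym (proj₂ (proj₂ (bis-sameLabel e {wordSegment d w} {wordSegment d w′} (bis S p)))))
        (trans (sym (lookup-letterAt d w (ρ p))) ρp≡a))
  invariant e w w′ (¬′ φ) le total S ¬s = λ s → ¬s (invariant e w′ w φ le (eq-sym e total) (similar-sym S) s)
  invariant e w w′ (φ ∧′ ψ) le total S (s , s′) =
    invariant e w w′ φ (≤-trans (m≤m⊔n _ _) le) total S s
    , invariant e w w′ ψ (≤-trans (m≤n⊔m _ _) le) total S s′
  invariant e w w′ (φ ∨′ ψ) le total S = map⊎
    (invariant e w w′ φ (≤-trans (m≤m⊔n _ _) le) total S)
    (invariant e w w′ ψ (≤-trans (m≤n⊔m _ _) le) total S)
  invariant (suc e) w w′ (∃′ v φ) (s≤s le) total S (i , s) =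
    let j , S′ = respond w w′ total S v i in j , invariant e w w′ φ le (eq-pred e total) S′ s
  invariant (suc e) w w′ (∀′ v φ) (s≤s le) total S s j =
    let i , S′ = respond w′ w (eq-sym (suc e) total) (similar-sym S) v j
    in invariant e w w′ φ le (eq-pred e total) (similar-sym S′) (s i)

  ⊨-invariant : ∀ w w′ φ → Eq (depth φ) (wordSegment d w) (wordSegment d w′) → w ⊨ φ → w′ ⊨ φ
  ⊨-invariant w w′ φ total = invariant (depth φ) w w′ φ ≤-refl total
    (record { bis = λ { (there (there ())) } ; ord = λ { (there (there ())) } })

-- The disjunction of the classes on whose words φ holds

anyOf : ∀ {A} → List (Closed A) → Closed A
anyOf []       = ¬ˢ ⊤ˢ
-- `Closed` has no disjunction, so it is expressed by De Morgan's law; `rankˢ` ignores negations,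
-- and decidability of satisfaction removes them again.
anyOf (φ ∷ φs) = ¬ˢ (¬ˢ φ ∧ˢ ¬ˢ anyOf φs)

rank-anyOf : ∀ {A d n} {B : List A} (cs : List (Class d n B)) → rankˢ (anyOf (map sentence cs)) ≤ n
rank-anyOf []       = z≤n
rank-anyOf (c ∷ cs) = ⊔-lub (rank≤ c) (rank-anyOf cs)

module _ {A : Set} (_≟_ : DecidableEquality A) (d : A) (w : List A) where

  anyOf⇔ : ∀ φs → (w ⊨ ⟦ anyOf φs ⟧) ⇔ Any (λ φ → w ⊨ ⟦ φ ⟧) φs
  anyOf⇔ []       = mk⇔ (λ no⊤ → ⊥-elim (no⊤ (from (⟦⟧⇔ _≟_ d w ⊤ˢ) tt))) λ ()
  anyOf⇔ (φ ∷ φs) = mk⇔ fwd bwd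
    where
    fwd : w ⊨ ⟦ anyOf (φ ∷ φs) ⟧ → Any (λ φ → w ⊨ ⟦ φ ⟧) (φ ∷ φs)
    fwd h with models? _≟_ w ⟦ φ ⟧ | models? _≟_ w ⟦ anyOf φs ⟧
    ... | yes p | _      = here p
    ... | no _  | yes ps = there (to (anyOf⇔ φs) ps)
    ... | no ¬p | no ¬ps = ⊥-elim (h (¬p , ¬ps))
    bwd : Any (λ φ → w ⊨ ⟦ φ ⟧) (φ ∷ φs) → w ⊨ ⟦ anyOf (φ ∷ φs) ⟧
    bwd (here p)   (¬p , _)  = ¬p p
    bwd (there ps) (_ , ¬ps) = ¬ps (from (anyOf⇔ φs) ps)

module _ {A : Set} (_≟_ : DecidableEquality A) (d : A) {n : ℕ} {B : List A} (∈B : ∀ a → a ∈ B)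
         (φ : Sentence A) (cs : Classes (depth φ) (suc n) B) where

  private
    selected : List (Class (depth φ) (suc n) B)
    selected = filter (λ c → models? _≟_ (word c) φ) (list cs)

  fromClasses : Sentence A
  fromClasses = ⟦ anyOf (map sentence selected) ⟧

  atMost-fromClasses : AtMost (suc n) (nnf fromClasses)
  atMost-fromClasses = atMost-nnf n (anyOf (map sentence selected))
    (rank-anyOf selected)

  -- Every word lies in a listed class, and it agrees on `φ` with the representative of any class
  -- whose sentence it satisfies; selecting classes by their representatives is therefore exact.
  fromClasses⇔ : ∀ w → (w ⊨ φ) ⇔ (w ⊨ fromClasses)
  fromClasses⇔ w = mk⇔ fwd bwd
    where
    equivalent-word : ∀ c → True (wordSegment d w) (sentence c) →
                      Eq (depth φ) (wordSegment d w) (wordSegment d (word c))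
    equivalent-word c true =
      sound {n = suc n} {B = B} c z≤n (λ _ → ∈B _) true (spells-letterAt d (word c))
    fwd : w ⊨ φ → w ⊨ fromClasses
    fwd w⊨φ =
      let c , c∈ , true = cover cs (letterAt d w) 0 (length w) z≤n (λ _ → ∈B _)
          c⊨φ = ⊨-invariant d w (word c) φ (equivalent-word c true) w⊨φ
      in from (anyOf⇔ _≟_ d w (map sentence selected))
           (Any.map⁺ (lose (∈-filter⁺ (λ c → models? _≟_ (word c) φ) c∈ c⊨φ)
             (from (⟦⟧⇔ _≟_ d w (sentence c)) true)))
    bwd : w ⊨ fromClasses → w ⊨ φ
    bwd w⊨χ =
      let c , c∈ , w⊨c = find (Any.map⁻ (to (anyOf⇔ _≟_ d w (map sentence selected)) w⊨χ))
          _ , c⊨φ = ∈-filter⁻ (λ c → models? _≟_ (word c) φ) {xs = list cs} c∈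
      in ⊨-invariant d (word c) w φ
           (eq-sym (depth φ) (equivalent-word c (to (⟦⟧⇔ _≟_ d w (sentence c)) w⊨c))) c⊨φ

corollary5p2 : ∀ (k : ℕ) → k ≥ 1 → (A : Set) → A ↔ Fin k →
    (L : Language A) → FO²Definable L → FO²DefinableWithBlocks k L
corollary5p2 (suc n) _ A A↔Fin L (φ , φ-defines) =
  χ ∧′ padding n , defines , numBlocks-pad n χ (atMost-fromClasses _≟_ d ∈-letters φ cs)
  where
  module I = Inverse A↔Fin

  _≟_ : DecidableEquality A
  _≟_ = via-injection (↔⇒↣ A↔Fin) Fin._≟_

  -- The alphabet is nonempty because `k ≥ 1`; this is where the default letter comes from.
  d : A
  d = I.from 0F

  letters : List A
  letters = map I.from (allFin (suc n))

  ∈-letters : ∀ a → a ∈ letters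
  ∈-letters a = subst (_∈ letters) (I.strictlyInverseʳ a) (∈-map⁺ I.from (∈-allFin (I.to a)))

  cs : Classes (depth φ) (suc n) letters
  cs = classes _≟_ (depth φ) (suc n) letters
    (≤-reflexive (trans (length-map I.from (allFin (suc n))) (length-tabulate {n = suc n} id)))

  χ : Sentence A
  χ = fromClasses _≟_ d ∈-letters φ cs

  defines : (χ ∧′ padding n) Defines L
  defines w = mk⇔
    (λ w∈L → to (fromClasses⇔ _≟_ d ∈-letters φ cs w) (to (φ-defines w) w∈L) , ⊨-padding _≟_ n w)
    (λ (w⊨χ , _) → from (φ-defines w) (from (fromClasses⇔ _≟_ d ∈-letters φ cs w) w⊨χ))
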